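{- In the Poisson arrival model, $\mathrm{OPT}\le\mathrm{NAT}$.
   Context: Let $I$ be a finite set of online vertex types and $J$ a finite set of offline vertices. For $i\in I$, $j\in J$, $w_{ij}\ge 0$ is the weight of matching an online vertex of type $i$ to $j$. Type $i$ has arrival rate $\lambda_i>0$, and $\Lambda=\sum_{i\in I}\lambda_i$. Poisson arrival model: the online vertices of each type $i$ arrive over the time interval $[0,1]$ according to independent Poisson processes of rate $\lambda_i$ (equivalently, the number of online vertices is Poisson with mean $\Lambda$, and each independently has type $i$ with probability $\lambda_i/\Lambda$). $\mathrm{OPT}$ is the expected total weight of the maximum weight matching in the realized bipartite graph between online vertices and $J$. $\mathrm{NAT}$ is the optimal value of the natural linear program: maximize $\sum_{i\in I}\sum_{j\in J}w_{ij}x_{ij}$ subject to $\sum_{j\in J}x_{ij}\le\lambda_i$ for all $i\in I$; $\sum_{i\in S}x_{ij}\le 1-\exp\big(-\sum_{i\in S}\lambda_i\big)$ for all $j\in J$ and all $S\subseteq I$; and $x_{ij}\ge0$ for all $i\in I$, $j\in J$. -}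

module Defs where

open import Algebra.Bundles.Raw using (RawSemiring)
open import Data.Bool.Base using (if_then_else_)
open import Data.Fin.Base using (Fin; zero; suc; toℕ)
import Data.Fin.Properties as Fin
open import Data.Fin.Subset using (Subset)
open import Data.Integer.Base using (+_; -[1+_])
import Data.Integer.Base as ℤ
import Data.Integer.Properties as ℤ
open import Data.List.Base as List using (List; []; _∷_)
open import Data.Maybe.Base using (Maybe; nothing; just; maybe)
import Data.Maybe.Properties as Maybe
open import Data.Nat.Base as ℕ using (ℕ; zero; suc; _!)
import Data.Nat.Properties as ℕ
open import Data.Product.Base using (∃; _×_; _,_; proj₁; proj₂)
open import Data.Rational.Base
open import Data.Rational.Properties
import Data.Rational.Unnormalised.Base as ℚᵘ
import Data.Rational.Unnormalised.Properties as ℚᵘ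
open import Data.Sum.Base using (inj₁; inj₂)
open import Data.Vec.Base as Vec using (Vec; []; _∷_)
open import Function.Base using (_∘_)
open import Level using (0ℓ)
open import Relation.Binary.PropositionalEquality
open import Relation.Nullary.Decidable using (Dec; _→-dec_)
open import Relation.Nullary.Decidable.Core using (dec⇒maybe)
open import Tactic.RingSolver using (solve-∀)
open import Tactic.RingSolver.Core.AlmostCommutativeRing
  using (AlmostCommutativeRing; fromCommutativeRing)

import Algebra.Definitions.RawSemiring +-*-rawSemiring as ℚS

module ℚ-Ring where
  ℚR : AlmostCommutativeRing 0ℓ 0ℓ
  ℚR = fromCommutativeRing +-*-commutativeRing (λ x → dec⇒maybe (0ℚ ≟ x))

open ℚ-Ring

module ℚ-Lemmas where
  half : ℚ → ℚ
  half ε = ½ * ε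

  half+half : ∀ ε → half ε + half ε ≡ ε
  half+half ε = trans (sym (*-distribʳ-+ ε ½ ½)) (*-identityˡ ε)

  *-pos : ∀ {p q} → 0ℚ < p → 0ℚ < q → 0ℚ < p * q
  *-pos {p} {q} 0<p 0<q =
    subst (_< p * q) (*-zeroʳ p) (*-monoʳ-<-pos p {{positive 0<p}} 0<q)

  half-pos : ∀ {ε} → 0ℚ < ε → 0ℚ < half ε
  half-pos {ε} = *-pos {½} {ε} (*<* (ℤ.+<+ (ℕ.s≤s ℕ.z≤n)))

  *-mono-≤ : ∀ {p q r s} → 0ℚ ≤ q → 0ℚ ≤ r → p ≤ q → r ≤ s → p * r ≤ q * s
  *-mono-≤ {p} {q} {r} {s} 0≤q 0≤r p≤q r≤s = ≤-trans
    (*-monoʳ-≤-nonNeg r {{nonNegative 0≤r}} p≤q)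
    (*-monoˡ-≤-nonNeg q {{nonNegative 0≤q}} r≤s)

  *-nonneg : ∀ {p q} → 0ℚ ≤ p → 0ℚ ≤ q → 0ℚ ≤ p * q
  *-nonneg {p} {q} 0≤p 0≤q =
    subst (_≤ p * q) (*-zeroʳ p) (*-monoˡ-≤-nonNeg p {{nonNegative 0≤p}} 0≤q)

  +-nonneg : ∀ p q → 0ℚ ≤ p → 0ℚ ≤ q → 0ℚ ≤ p + q
  +-nonneg p q 0≤p 0≤q = subst (_≤ p + q) (+-identityˡ 0ℚ) (+-mono-≤ 0≤p 0≤q)

  ∣∣-mono-* : ∀ p r {q s} → ∣ p ∣ ≤ q → ∣ r ∣ ≤ s → ∣ p * r ∣ ≤ q * s
  ∣∣-mono-* p r {q} {s} p≤q r≤s = subst (_≤ q * s) (sym (∣p*q∣≡∣p∣*∣q∣ p r))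
    (*-mono-≤ (≤-trans (0≤∣p∣ p) p≤q) (0≤∣p∣ r) p≤q r≤s)

  ∣∣-mono-+ : ∀ p r {q s} → ∣ p ∣ ≤ q → ∣ r ∣ ≤ s → ∣ p + r ∣ ≤ q + s
  ∣∣-mono-+ p r {q} {s} p≤q r≤s = ≤-trans (∣p+q∣≤∣p∣+∣q∣ p r) (+-mono-≤ p≤q r≤s)

  p≤∣p∣ : ∀ p → p ≤ ∣ p ∣
  p≤∣p∣ p with ≤-total 0ℚ p
  ... | inj₁ 0≤p = ≤-reflexive (sym (0≤p⇒∣p∣≡p 0≤p))
  ... | inj₂ p≤0 = ≤-trans p≤0 (0≤∣p∣ p)

  ∣p-q∣≡∣q-p∣ : ∀ p q → ∣ p - q ∣ ≡ ∣ q - p ∣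
  ∣p-q∣≡∣q-p∣ p q = trans (sym (∣-p∣≡∣p∣ (p - q))) (cong ∣_∣ (lemma p q))
    where
    lemma : ∀ p q → - (p - q) ≡ q - p
    lemma = solve-∀ ℚR

  p≤q+[p-q] : ∀ p q → p ≡ q + (p - q)
  p≤q+[p-q] = solve-∀ ℚR

  dist⇒≤ : ∀ p q {ε} → ∣ p - q ∣ ≤ ε → p ≤ q + ε
  dist⇒≤ p q d = ≤-trans (≤-reflexive (p≤q+[p-q] p q))
    (+-monoʳ-≤ q (≤-trans (p≤∣p∣ (p - q)) d))

  ≤⇒-≤ : ∀ p q {ε} → p ≤ q + ε → p - q ≤ ε
  ≤⇒-≤ p q {ε} le = ≤-trans (+-monoˡ-≤ (- q) le) (≤-reflexive (lemma q ε))
    where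
    lemma : ∀ q ε → q + ε - q ≡ ε
    lemma = solve-∀ ℚR

  ≤⇒dist : ∀ p q {ε} → p ≤ q + ε → q ≤ p + ε → ∣ p - q ∣ ≤ ε
  ≤⇒dist p q {ε} p≤ q≤ with ∣p∣≡p∨∣p∣≡-p (p - q)
  ... | inj₁ eq = subst (_≤ ε) (sym eq) (≤⇒-≤ p q p≤)
  ... | inj₂ eq = subst (_≤ ε) (sym (trans eq (lemma p q))) (≤⇒-≤ q p q≤)
    where
    lemma : ∀ p q → - (p - q) ≡ q - p
    lemma = solve-∀ ℚR

  fromℕ : ℕ → ℚ
  fromℕ zero    = 0ℚ
  fromℕ (suc n) = 1ℚ + fromℕ n

  fromℕ≡/ : ∀ n → fromℕ n ≡ + n / 1
  fromℕ≡/ zero    = refl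
  fromℕ≡/ (suc n) = toℚᵘ-injective (begin-equality
    toℚᵘ (1ℚ + fromℕ n)             ≃⟨ toℚᵘ-homo-+ 1ℚ (fromℕ n) ⟩
    ℚᵘ.1ℚᵘ ℚᵘ.+ toℚᵘ (fromℕ n)      ≡⟨ cong (λ q → ℚᵘ.1ℚᵘ ℚᵘ.+ toℚᵘ q) (fromℕ≡/ n) ⟩
    ℚᵘ.1ℚᵘ ℚᵘ.+ toℚᵘ (+ n / 1)      ≃⟨ ℚᵘ.+-congʳ ℚᵘ.1ℚᵘ (toℚᵘ-fromℚᵘ (ℚᵘ.mkℚᵘ (+ n) 0)) ⟩
    ℚᵘ.1ℚᵘ ℚᵘ.+ ℚᵘ.mkℚᵘ (+ n) 0     ≃⟨ ℚᵘ.*≡* (cong (λ z → (+ 1 ℤ.+ z) ℤ.* + 1) (ℤ.*-identityʳ (+ n))) ⟩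
    ℚᵘ.mkℚᵘ (+ suc n) 0             ≃⟨ toℚᵘ-fromℚᵘ (ℚᵘ.mkℚᵘ (+ suc n) 0) ⟨
    toℚᵘ (+ suc n / 1)              ∎)
    where open ℚᵘ.≤-Reasoning

  fromℕ-nonneg : ∀ n → 0ℚ ≤ fromℕ n
  fromℕ-nonneg zero    = ≤-refl
  fromℕ-nonneg (suc n) = +-nonneg 1ℚ (fromℕ n) (*≤* (ℤ.+≤+ ℕ.z≤n)) (fromℕ-nonneg n)

  fromℕ-pos : ∀ n → 0ℚ < fromℕ (suc n)
  fromℕ-pos n = +-mono-<-≤ {0ℚ} {1ℚ} (*<* (ℤ.+<+ (ℕ.s≤s ℕ.z≤n))) (fromℕ-nonneg n)

  fromℕ-mono : ∀ {m n} → m ℕ.≤ n → fromℕ m ≤ fromℕ n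
  fromℕ-mono {n = n} ℕ.z≤n = fromℕ-nonneg n
  fromℕ-mono (ℕ.s≤s le)    = +-monoʳ-≤ 1ℚ (fromℕ-mono le)

  fromℕ-* : ∀ m n → fromℕ (m ℕ.* n) ≡ fromℕ m * fromℕ n
  fromℕ-* zero    n = sym (*-zeroˡ (fromℕ n))
  fromℕ-* (suc m) n = trans (fromℕ-+ n (m ℕ.* n))
    (trans (cong (λ x → fromℕ n + x) (fromℕ-* m n)) (lemma (fromℕ m) (fromℕ n)))
    where
    fromℕ-+ : ∀ a b → fromℕ (a ℕ.+ b) ≡ fromℕ a + fromℕ b
    fromℕ-+ zero    b = sym (+-identityˡ (fromℕ b))
    fromℕ-+ (suc a) b = trans (cong (λ q → 1ℚ + q) (fromℕ-+ a b)) (sym (+-assoc 1ℚ (fromℕ a) (fromℕ b)))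
    lemma : ∀ a b → b + a * b ≡ (1ℚ + a) * b
    lemma = solve-∀ ℚR

  1/n*n : ∀ n .{{_ : ℕ.NonZero n}} → (+ 1 / n) * fromℕ n ≡ 1ℚ
  1/n*n n@(suc m) = trans (cong ((+ 1 / n) *_) (fromℕ≡/ n)) (toℚᵘ-injective (begin-equality
    toℚᵘ ((+ 1 / n) * (+ n / 1))            ≃⟨ toℚᵘ-homo-* (+ 1 / n) (+ n / 1) ⟩
    toℚᵘ (+ 1 / n) ℚᵘ.* toℚᵘ (+ n / 1)      ≃⟨ ℚᵘ.*-cong (toℚᵘ-fromℚᵘ (ℚᵘ.mkℚᵘ (+ 1) m)) (toℚᵘ-fromℚᵘ (ℚᵘ.mkℚᵘ (+ n) 0)) ⟩
    ℚᵘ.mkℚᵘ (+ 1) m ℚᵘ.* ℚᵘ.mkℚᵘ (+ n) 0    ≃⟨ ℚᵘ.*≡* (cong +_ (lemma n)) ⟩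
    ℚᵘ.1ℚᵘ                                  ∎))
    where
    open ℚᵘ.≤-Reasoning
    lemma : ∀ n → (1 ℕ.* n) ℕ.* 1 ≡ 1 ℕ.* (n ℕ.* 1)
    lemma n = ℕ.*-assoc 1 n 1

  archimedean : ∀ p → ∃ λ N → p ≤ fromℕ N
  archimedean p@(mkℚ -[1+ n ] d _) = 0 , *≤* ℤ.-≤+
  archimedean p@(mkℚ (+ n) d _) = n , subst (p ≤_) (sym (fromℕ≡/ n))
    (toℚᵘ-cancel-≤ (ℚᵘ.≤-respʳ-≃ (ℚᵘ.≃-sym (toℚᵘ-fromℚᵘ (ℚᵘ.mkℚᵘ (+ n) 0)))
      (ℚᵘ.*≤* (ℤ.*-monoˡ-≤-nonNeg (+ n) (ℤ.+≤+ (ℕ.s≤s ℕ.z≤n))))))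

  archimedean-* : ∀ c {ε} → 0ℚ < ε → ∃ λ N → ∀ n → N ℕ.≤ n → c ≤ fromℕ n * ε
  archimedean-* c {ε} 0<ε = let N , le = archimedean (c * inv) in
    N , λ n N≤n → begin
      c                 ≡⟨ sym (*-identityʳ c) ⟩
      c * 1ℚ            ≡⟨ cong (c *_) (sym (*-inverseˡ ε)) ⟩
      c * (inv * ε)     ≡⟨ sym (*-assoc c inv ε) ⟩
      (c * inv) * ε     ≤⟨ *-monoʳ-≤-nonNeg ε (≤-trans le (fromℕ-mono N≤n)) ⟩
      fromℕ n * ε       ∎
    where
    open ≤-Reasoning
    instance
      ε-pos : Positive ε
      ε-pos = positive 0<ε
      ε-nonNeg : NonNegative ε
      ε-nonNeg = pos⇒nonNeg ε
      ε-nonZero : NonZero ε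
      ε-nonZero = pos⇒nonZero ε
    inv = 1/ ε

open ℚ-Lemmas

IsCauchy : (ℕ → ℚ) → Set
IsCauchy s = ∀ ε → 0ℚ < ε → ∃ λ N → ∀ m n → N ℕ.≤ m → N ℕ.≤ n → ∣ s m - s n ∣ ≤ ε

module Cauchy where
  opaque
    const-cauchy : ∀ q → IsCauchy (λ _ → q)
    const-cauchy q ε 0<ε = 0 , λ _ _ _ _ →
      subst (λ r → ∣ r ∣ ≤ ε) (sym (+-inverseʳ q)) (<⇒≤ 0<ε)

  opaque
    +-cauchy : ∀ s t → IsCauchy s → IsCauchy t → IsCauchy (λ n → s n + t n)
    +-cauchy s t cs ct ε 0<ε =
      let M , hs = cs (half ε) (half-pos 0<ε)
          N , ht = ct (half ε) (half-pos 0<ε)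
      in M ℕ.⊔ N , λ m n le le′ → begin
        ∣ (s m + t m) - (s n + t n) ∣    ≡⟨ cong ∣_∣ (lemma (s m) (t m) (s n) (t n)) ⟩
        ∣ (s m - s n) + (t m - t n) ∣    ≤⟨ ∣∣-mono-+ (s m - s n) (t m - t n)
                                             (hs m n (ℕ.m⊔n≤o⇒m≤o M N le) (ℕ.m⊔n≤o⇒m≤o M N le′))
                                             (ht m n (ℕ.m⊔n≤o⇒n≤o M N le) (ℕ.m⊔n≤o⇒n≤o M N le′)) ⟩
        half ε + half ε                  ≡⟨ half+half ε ⟩
        ε                                ∎
      where
      open ≤-Reasoning
      lemma : ∀ a b c d → (a + b) - (c + d) ≡ (a - c) + (b - d)
      lemma = solve-∀ ℚR

  opaque
    neg-cauchy : ∀ s → IsCauchy s → IsCauchy (λ n → - s n)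
    neg-cauchy s cs ε 0<ε = let N , h = cs ε 0<ε in
      N , λ m n le le′ → subst (_≤ ε)
        (trans (∣p-q∣≡∣q-p∣ (s m) (s n)) (cong ∣_∣ (lemma (s m) (s n)))) (h m n le le′)
      where
      lemma : ∀ a b → b - a ≡ - a - - b
      lemma = solve-∀ ℚR

  bounded : ∀ s → IsCauchy s → ∃ λ B → 0ℚ < B × ∃ λ N → ∀ n → N ℕ.≤ n → ∣ s n ∣ ≤ B
  bounded s cs = let N , h = cs 1ℚ (fromℕ-pos 0) in
    ∣ s N ∣ + 1ℚ , +-mono-≤-< (0≤∣p∣ (s N)) (fromℕ-pos 0) , N , λ n le →
      subst (λ q → ∣ q ∣ ≤ ∣ s N ∣ + 1ℚ) (sym (p≤q+[p-q] (s n) (s N)))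
        (∣∣-mono-+ (s N) (s n - s N) ≤-refl (h n N le ℕ.≤-refl))

  opaque
    *-cauchy : ∀ s t → IsCauchy s → IsCauchy t → IsCauchy (λ n → s n * t n)
    *-cauchy s t cs ct ε 0<ε =
      let A , 0<A , K , hA = bounded s cs
          B , 0<B , L , hB = bounded t ct
          instance
            A-pos = positive 0<A
            B-pos = positive 0<B
            A-nz  = pos⇒nonZero A
            B-nz  = pos⇒nonZero B
          δ = half ε * 1/ B
          η = half ε * 1/ A
          M , hs = cs δ (*-pos (half-pos 0<ε) (positive⁻¹ (1/ B) {{1/pos⇒pos B}}))
          N , ht = ct η (*-pos (half-pos 0<ε) (positive⁻¹ (1/ A) {{1/pos⇒pos A}}))
      in (K ℕ.⊔ L) ℕ.⊔ (M ℕ.⊔ N) , λ m n le le′ →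
        let KL≤m = ℕ.m⊔n≤o⇒m≤o (K ℕ.⊔ L) (M ℕ.⊔ N) le
            KL≤n = ℕ.m⊔n≤o⇒m≤o (K ℕ.⊔ L) (M ℕ.⊔ N) le′
            MN≤m = ℕ.m⊔n≤o⇒n≤o (K ℕ.⊔ L) (M ℕ.⊔ N) le
            MN≤n = ℕ.m⊔n≤o⇒n≤o (K ℕ.⊔ L) (M ℕ.⊔ N) le′
        in begin
        ∣ s m * t m - s n * t n ∣                  ≡⟨ cong ∣_∣ (lemma (s m) (t m) (s n) (t n)) ⟩
        ∣ s m * (t m - t n) + (s m - s n) * t n ∣  ≤⟨ ∣∣-mono-+ (s m * (t m - t n)) ((s m - s n) * t n)
              (∣∣-mono-* (s m) (t m - t n) (hA m (ℕ.m⊔n≤o⇒m≤o K L KL≤m))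
                         (ht m n (ℕ.m⊔n≤o⇒n≤o M N MN≤m) (ℕ.m⊔n≤o⇒n≤o M N MN≤n)))
              (∣∣-mono-* (s m - s n) (t n) (hs m n (ℕ.m⊔n≤o⇒m≤o M N MN≤m) (ℕ.m⊔n≤o⇒m≤o M N MN≤n))
                         (hB n (ℕ.m⊔n≤o⇒n≤o K L KL≤n))) ⟩
        A * η + δ * B                              ≡⟨ lemma₂ (half ε) A B (1/ A) (1/ B) ⟩
        half ε * (A * 1/ A) + half ε * (B * 1/ B)  ≡⟨ cong₂ (λ a b → half ε * a + half ε * b)
                                                       (*-inverseʳ A) (*-inverseʳ B) ⟩
        half ε * 1ℚ + half ε * 1ℚ                  ≡⟨ cong (λ x → x + x) (*-identityʳ (half ε)) ⟩
        half ε + half ε                            ≡⟨ half+half ε ⟩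
        ε                                          ∎
      where
      open ≤-Reasoning
      lemma : ∀ a b c d → a * b - c * d ≡ a * (b - d) + (a - c) * d
      lemma = solve-∀ ℚR
      lemma₂ : ∀ h a b a′ b′ → a * (h * a′) + (h * b′) * b ≡ h * (a * a′) + h * (b * b′)
      lemma₂ = solve-∀ ℚR

  ⊔-shift : ∀ a b c d {ε} → a ≤ c + ε → b ≤ d + ε → a ⊔ b ≤ (c ⊔ d) + ε
  ⊔-shift a b c d {ε} a≤ b≤ = ⊔-lub
    (≤-trans a≤ (+-monoˡ-≤ ε (p≤p⊔q c d)))
    (≤-trans b≤ (+-monoˡ-≤ ε (p≤q⊔p c d)))

  opaque
    ⊔-cauchy : ∀ s t → IsCauchy s → IsCauchy t → IsCauchy (λ n → s n ⊔ t n)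
    ⊔-cauchy s t cs ct ε 0<ε =
      let M , hs = cs ε 0<ε
          N , ht = ct ε 0<ε
          step : ∀ m n → M ℕ.⊔ N ℕ.≤ m → M ℕ.⊔ N ℕ.≤ n → s m ⊔ t m ≤ (s n ⊔ t n) + ε
          step m n le le′ = ⊔-shift (s m) (t m) (s n) (t n)
            (dist⇒≤ (s m) (s n) (hs m n (ℕ.m⊔n≤o⇒m≤o M N le) (ℕ.m⊔n≤o⇒m≤o M N le′)))
            (dist⇒≤ (t m) (t n) (ht m n (ℕ.m⊔n≤o⇒n≤o M N le) (ℕ.m⊔n≤o⇒n≤o M N le′)))
      in M ℕ.⊔ N , λ m n le le′ → ≤⇒dist (s m ⊔ t m) (s n ⊔ t n) (step m n le le′) (step n m le′ le)

open Cauchy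

-- Two Cauchy sequences represent the same real when _≤ℝ_ holds in both
-- directions.
record ℝ : Set where
  no-eta-equality; pattern
  constructor mkℝ
  field
    seq    : ℕ → ℚ
    cauchy : IsCauchy seq

open ℝ public

infix  4 _≤ℝ_ _<ℝ_ _≈ℝ_
infixl 6 _+ℝ_ _⊔ℝ_
infixl 7 _*ℝ_
infix  8 -ℝ_

_≤ℝ_ : ℝ → ℝ → Set
x ≤ℝ y = ∀ ε → 0ℚ < ε → ∃ λ N → ∀ n → N ℕ.≤ n → seq x n ≤ seq y n + ε

_<ℝ_ : ℝ → ℝ → Set
x <ℝ y = ∃ λ ε → 0ℚ < ε × ∃ λ N → ∀ n → N ℕ.≤ n → seq x n + ε ≤ seq y n

_≈ℝ_ : ℝ → ℝ → Set
x ≈ℝ y = x ≤ℝ y × y ≤ℝ x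

fromℚ : ℚ → ℝ
fromℚ q = mkℝ (λ _ → q) (const-cauchy q)

0ℝ 1ℝ : ℝ
0ℝ = fromℚ 0ℚ
1ℝ = fromℚ 1ℚ

_+ℝ_ _*ℝ_ _⊔ℝ_ : ℝ → ℝ → ℝ
x +ℝ y = mkℝ (λ n → seq x n + seq y n) (+-cauchy (seq x) (seq y) (cauchy x) (cauchy y))
x *ℝ y = mkℝ (λ n → seq x n * seq y n) (*-cauchy (seq x) (seq y) (cauchy x) (cauchy y))
x ⊔ℝ y = mkℝ (λ n → seq x n ⊔ seq y n) (⊔-cauchy (seq x) (seq y) (cauchy x) (cauchy y))

-ℝ_ : ℝ → ℝ
-ℝ x = mkℝ (λ n → - seq x n) (neg-cauchy (seq x) (cauchy x))

ℝ-rawSemiring : RawSemiring 0ℓ 0ℓ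
ℝ-rawSemiring = record
  { Carrier = ℝ ; _≈_ = _≈ℝ_ ; _+_ = _+ℝ_ ; _*_ = _*ℝ_ ; 0# = 0ℝ ; 1# = 1ℝ }

open import Algebra.Definitions.RawSemiring ℝ-rawSemiring public
  using (sum; product; _^_)

-- Exchanging m and n turns the one-sided bound into ∣ s m - s n ∣ ≤ ε.
IsCauchyℝ : (ℕ → ℝ) → Set
IsCauchyℝ s = ∀ ε → 0ℚ < ε → ∃ λ N → ∀ m n → N ℕ.≤ m → N ℕ.≤ n → s m ≤ℝ s n +ℝ fromℚ ε

module Limits where
  module Limit (s : ℕ → ℝ) (cs : IsCauchyℝ s) where
    open ≤-Reasoning

    δ : ℕ → ℚ
    δ n = + 1 / suc n

    0<δ : ∀ n → 0ℚ < δ n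
    0<δ n = positive⁻¹ (δ n) {{normalize-pos 1 (suc n)}}

    index : ℕ → ℕ
    index n = proj₁ (cauchy (s n) (δ n) (0<δ n))

    -- q n is within 1/(n+1) of the real s n.
    q : ℕ → ℚ
    q n = seq (s n) (index n)

    close : ∀ n l → index n ℕ.≤ l → ∣ q n - seq (s n) l ∣ ≤ δ n
    close n l le = proj₂ (cauchy (s n) (δ n) (0<δ n)) (index n) l ℕ.≤-refl le

    δ-small : ∀ {η} → 0ℚ < η → ∃ λ N → ∀ n → N ℕ.≤ n → δ n ≤ η
    δ-small {η} 0<η = let N , h = archimedean-* 1ℚ 0<η in
      N , λ n N≤n → *-cancelʳ-≤-pos (fromℕ (suc n)) {{positive (fromℕ-pos n)}} (begin
        δ n * fromℕ (suc n)   ≡⟨ 1/n*n (suc n) ⟩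
        1ℚ                    ≤⟨ h (suc n) (ℕ.m≤n⇒m≤1+n N≤n) ⟩
        fromℕ (suc n) * η     ≡⟨ *-comm (fromℕ (suc n)) η ⟩
        η * fromℕ (suc n)     ∎)

    below : ∀ n l η → index n ℕ.≤ l → δ n ≤ η → q n ≤ seq (s n) l + η
    below n l η i≤l δ≤ = dist⇒≤ (q n) (seq (s n) l) (≤-trans (close n l i≤l) δ≤)

    above : ∀ n l η → index n ℕ.≤ l → δ n ≤ η → seq (s n) l ≤ q n + η
    above n l η i≤l δ≤ = dist⇒≤ (seq (s n) l) (q n)
      (subst (_≤ η) (∣p-q∣≡∣q-p∣ (q n) (seq (s n) l)) (≤-trans (close n l i≤l) δ≤))

    q-cauchy′ : IsCauchy q
    q-cauchy′ ε 0<ε = K ℕ.⊔ M , λ m n le le′ →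
        ≤⇒dist (q m) (q n) (step m n le le′) (step n m le′ le)
      where
      η = half (half ε)
      0<η = half-pos (half-pos 0<ε)
      K = proj₁ (δ-small 0<η)
      hδ = proj₂ (δ-small 0<η)
      M = proj₁ (cs η 0<η)
      hs = proj₂ (cs η 0<η)

      lemma : ∀ a h → (a + h) + h + h + h ≡ a + ((h + h) + (h + h))
      lemma = solve-∀ ℚR

      step : ∀ m n → K ℕ.⊔ M ℕ.≤ m → K ℕ.⊔ M ℕ.≤ n → q m ≤ q n + ε
      step m n le le′ = begin
        q m                          ≤⟨ below m l η (ℕ.m⊔n≤o⇒m≤o (index m) (index n) i≤l)
                                                  (hδ m (ℕ.m⊔n≤o⇒m≤o K M le)) ⟩
        seq (s m) l + η              ≤⟨ +-monoˡ-≤ η (proj₂ close-mn l (ℕ.m≤n⊔m (index m ℕ.⊔ index n) L)) ⟩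
        seq (s n) l + η + η + η      ≤⟨ +-monoˡ-≤ η (+-monoˡ-≤ η (+-monoˡ-≤ η back)) ⟩
        (q n + η) + η + η + η        ≡⟨ lemma (q n) η ⟩
        q n + ((η + η) + (η + η))    ≡⟨ cong (λ x → q n + (x + x)) (half+half (half ε)) ⟩
        q n + (half ε + half ε)      ≡⟨ cong (λ x → q n + x) (half+half ε) ⟩
        q n + ε                      ∎
        where
        close-mn = hs m n (ℕ.m⊔n≤o⇒n≤o K M le) (ℕ.m⊔n≤o⇒n≤o K M le′) η 0<η
        L = proj₁ close-mn
        l = (index m ℕ.⊔ index n) ℕ.⊔ L
        i≤l : index m ℕ.⊔ index n ℕ.≤ l
        i≤l = ℕ.m≤m⊔n (index m ℕ.⊔ index n) L
        back : seq (s n) l ≤ q n + η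
        back = above n l η (ℕ.m⊔n≤o⇒n≤o (index m) (index n) i≤l) (hδ n (ℕ.m⊔n≤o⇒m≤o K M le′))

    opaque
      q-cauchy : IsCauchy q
      q-cauchy = q-cauchy′

open Limits

lim : (s : ℕ → ℝ) → IsCauchyℝ s → ℝ
lim s cs = mkℝ (Limit.q s cs) (Limit.q-cauchy s cs)

lim-converges : ∀ s cs ε → 0ℚ < ε → ∃ λ N → ∀ n → N ℕ.≤ n →
                s n ≤ℝ lim s cs +ℝ fromℚ ε × lim s cs ≤ℝ s n +ℝ fromℚ ε
lim-converges s cs ε 0<ε = M , λ n M≤n →
  (λ α 0<α → rank n α 0<α , λ l le → lower n α 0<α M≤n l le) ,
  (λ α 0<α → rank n α 0<α , λ l le → upper n α 0<α M≤n l le)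
  where
  open Limit s cs
  open ≤-Reasoning
  η = half ε
  0<η = half-pos 0<ε
  M = proj₁ (cs η 0<η)
  K = proj₁ (δ-small 0<η)

  rank : ∀ n α → 0ℚ < α → ℕ
  rank n α 0<α = (M ℕ.⊔ K) ℕ.⊔ proj₁ (cauchy (s n) (half α) (half-pos 0<α))

  collect : ∀ a h b → ((a + h) + h + b) + b ≡ a + (h + h) + (b + b)
  collect = solve-∀ ℚR

  total : ∀ a α → ((a + η) + η + half α) + half α ≡ a + ε + α
  total a α = trans (collect a η (half α))
    (cong₂ (λ x y → a + x + y) (half+half ε) (half+half α))

  module _ (n : ℕ) (α : ℚ) (0<α : 0ℚ < α) (M≤n : M ℕ.≤ n)
           (l : ℕ) (le : rank n α 0<α ℕ.≤ l) where
    β = half α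
    R = proj₁ (cauchy (s n) β (half-pos 0<α))
    M≤l = ℕ.m⊔n≤o⇒m≤o M K (ℕ.m⊔n≤o⇒m≤o (M ℕ.⊔ K) R le)
    δ≤η = proj₂ (δ-small 0<η) l (ℕ.m⊔n≤o⇒n≤o M K (ℕ.m⊔n≤o⇒m≤o (M ℕ.⊔ K) R le))
    R≤l = ℕ.m⊔n≤o⇒n≤o (M ℕ.⊔ K) R le
    nl = proj₂ (cs η 0<η) n l M≤n M≤l β (half-pos 0<α)
    ln = proj₂ (cs η 0<η) l n M≤l M≤n β (half-pos 0<α)
    k = (proj₁ nl ℕ.⊔ proj₁ ln) ℕ.⊔ (R ℕ.⊔ index l)
    nl≤k = ℕ.≤-trans (ℕ.m≤m⊔n (proj₁ nl) (proj₁ ln)) (ℕ.m≤m⊔n _ (R ℕ.⊔ index l))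
    ln≤k = ℕ.≤-trans (ℕ.m≤n⊔m (proj₁ nl) (proj₁ ln)) (ℕ.m≤m⊔n _ (R ℕ.⊔ index l))
    R≤k = ℕ.≤-trans (ℕ.m≤m⊔n R (index l)) (ℕ.m≤n⊔m (proj₁ nl ℕ.⊔ proj₁ ln) _)
    i≤k = ℕ.≤-trans (ℕ.m≤n⊔m R (index l)) (ℕ.m≤n⊔m (proj₁ nl ℕ.⊔ proj₁ ln) _)
    within = proj₂ (cauchy (s n) β (half-pos 0<α))

    lower : seq (s n) l ≤ q l + ε + α
    lower = begin
      seq (s n) l                ≤⟨ dist⇒≤ (seq (s n) l) (seq (s n) k) (within l k R≤l R≤k) ⟩
      seq (s n) k + β            ≤⟨ +-monoˡ-≤ β (proj₂ nl k nl≤k) ⟩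
      seq (s l) k + η + β + β    ≤⟨ +-monoˡ-≤ β (+-monoˡ-≤ β (+-monoˡ-≤ η (above l k η i≤k δ≤η))) ⟩
      q l + η + η + β + β        ≡⟨ total (q l) α ⟩
      q l + ε + α                ∎

    upper : q l ≤ seq (s n) l + ε + α
    upper = begin
      q l                          ≤⟨ below l k η i≤k δ≤η ⟩
      seq (s l) k + η              ≤⟨ +-monoˡ-≤ η (proj₂ ln k ln≤k) ⟩
      seq (s n) k + η + β + η      ≤⟨ +-monoˡ-≤ η (+-monoˡ-≤ β (+-monoˡ-≤ η
                                        (dist⇒≤ (seq (s n) k) (seq (s n) l) (within k l R≤k R≤l)))) ⟩
      seq (s n) l + β + η + β + η  ≡⟨ shuffle (seq (s n) l) η β ⟩
      seq (s n) l + η + η + β + β  ≡⟨ total (seq (s n) l) α ⟩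
      seq (s n) l + ε + α          ∎
      where
      shuffle : ∀ a h b → a + b + h + b + h ≡ a + h + h + b + b
      shuffle = solve-∀ ℚR

module SumLemmas where
  seq-sum : ∀ {n} (f : Fin n → ℝ) l → seq (sum f) l ≡ ℚS.sum (λ i → seq (f i) l)
  seq-sum {zero}  f l = refl
  seq-sum {suc n} f l = cong (λ q → seq (f zero) l + q) (seq-sum (f ∘ suc) l)

  seq-^ : ∀ x k l → seq (x ^ k) l ≡ seq x l ℚS.^ k
  seq-^ x zero    l = refl
  seq-^ x (suc k) l = cong (λ q → seq x l * q) (seq-^ x k l)

  ∣sum∣≤ : ∀ {n} (f g : Fin n → ℚ) → (∀ i → ∣ f i ∣ ≤ g i) → ∣ ℚS.sum f ∣ ≤ ℚS.sum g
  ∣sum∣≤ {zero}  f g h = ≤-refl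
  ∣sum∣≤ {suc n} f g h = ∣∣-mono-+ (f zero) (ℚS.sum (f ∘ suc)) (h zero)
    (∣sum∣≤ (f ∘ suc) (g ∘ suc) (h ∘ suc))

  Σ< : ℕ → (ℕ → ℚ) → ℚ
  Σ< n f = ℚS.sum {n} (f ∘ toℕ)

  Σ<-split : ∀ m d f → Σ< (m ℕ.+ d) f ≡ Σ< m f + Σ< d (λ j → f (m ℕ.+ j))
  Σ<-split zero    d f = sym (+-identityˡ _)
  Σ<-split (suc m) d f = trans (cong (λ q → f 0 + q) (Σ<-split m d (f ∘ suc)))
    (sym (+-assoc (f 0) (Σ< m (f ∘ suc)) (Σ< d (λ j → f (suc m ℕ.+ j)))))

  Σ<-* : ∀ n f c → Σ< n (λ k → f k * c) ≡ Σ< n f * c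
  Σ<-* zero    f c = sym (*-zeroˡ c)
  Σ<-* (suc n) f c = trans (cong (λ q → f 0 * c + q) (Σ<-* n (f ∘ suc) c))
    (sym (*-distribʳ-+ c (f 0) (Σ< n (f ∘ suc))))

  Σ<-minus : ∀ n f g → Σ< n (λ k → f k - g k) ≡ Σ< n f - Σ< n g
  Σ<-minus zero    f g = refl
  Σ<-minus (suc n) f g = trans (cong (λ q → (f 0 - g 0) + q) (Σ<-minus n (f ∘ suc) (g ∘ suc)))
    (lemma (f 0) (g 0) (Σ< n (f ∘ suc)) (Σ< n (g ∘ suc)))
    where
    lemma : ∀ a b c d → (a - b) + (c - d) ≡ (a + c) - (b + d)
    lemma = solve-∀ ℚR

  Σ<-tail : ∀ m n f → m ℕ.≤ n → Σ< n f - Σ< m f ≡ Σ< (n ℕ.∸ m) (λ j → f (m ℕ.+ j))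
  Σ<-tail m n f m≤n = trans
    (cong (_- Σ< m f) (trans (cong (λ k → Σ< k f) (sym (ℕ.m+[n∸m]≡n m≤n))) (Σ<-split m (n ℕ.∸ m) f)))
    (lemma (Σ< m f) (Σ< (n ℕ.∸ m) (λ j → f (m ℕ.+ j))))
    where
    lemma : ∀ a b → (a + b) - a ≡ b
    lemma = solve-∀ ℚR

  Σ<-diff : ∀ m n f g → (∀ k → ∣ f k ∣ ≤ g k) → m ℕ.≤ n →
            ∣ Σ< n f - Σ< m f ∣ ≤ Σ< n g - Σ< m g
  Σ<-diff m n f g h m≤n = subst₂ (λ p q → ∣ p ∣ ≤ q)
    (sym (Σ<-tail m n f m≤n)) (sym (Σ<-tail m n g m≤n))
    (∣sum∣≤ {n ℕ.∸ m} _ _ (λ j → h (m ℕ.+ toℕ j)))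

  ordered-cauchy : ∀ s → (∀ ε → 0ℚ < ε → ∃ λ N → ∀ m n → N ℕ.≤ m → m ℕ.≤ n → ∣ s n - s m ∣ ≤ ε) →
                   IsCauchy s
  ordered-cauchy s h ε 0<ε = proj₁ (h ε 0<ε) , go
    where
    go : ∀ m n → proj₁ (h ε 0<ε) ℕ.≤ m → proj₁ (h ε 0<ε) ℕ.≤ n → ∣ s m - s n ∣ ≤ ε
    go m n N≤m N≤n with ℕ.≤-total m n
    ... | inj₁ m≤n = subst (_≤ ε) (∣p-q∣≡∣q-p∣ (s n) (s m)) (proj₂ (h ε 0<ε) m n N≤m m≤n)
    ... | inj₂ n≤m = proj₂ (h ε 0<ε) n m N≤n n≤m

  cauchy-cong : ∀ {s t} → (∀ n → s n ≡ t n) → IsCauchy s → IsCauchy t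
  cauchy-cong eq cs ε 0<ε = let N , h = cs ε 0<ε in
    N , λ m n le le′ → subst₂ (λ a b → ∣ a - b ∣ ≤ ε) (eq m) (eq n) (h m n le le′)

  dominated : ∀ s t → IsCauchy t →
              (∃ λ L → ∀ l → L ℕ.≤ l → ∀ m n → m ℕ.≤ n → ∣ seq (s n) l - seq (s m) l ∣ ≤ t n - t m) →
              IsCauchyℝ s
  dominated s t ct (L , dom) ε 0<ε = N , λ m n N≤m N≤n ε′ 0<ε′ → L , λ l L≤l → begin
      seq (s m) l               ≤⟨ dist⇒≤ (seq (s m) l) (seq (s n) l) (near m n N≤m N≤n l L≤l) ⟩
      seq (s n) l + ε           ≡⟨ sym (+-identityʳ (seq (s n) l + ε)) ⟩
      seq (s n) l + ε + 0ℚ      ≤⟨ +-monoʳ-≤ (seq (s n) l + ε) (<⇒≤ 0<ε′) ⟩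
      seq (s n) l + ε + ε′      ∎
    where
    open ≤-Reasoning
    N = proj₁ (ct ε 0<ε)
    near : ∀ m n → N ℕ.≤ m → N ℕ.≤ n → ∀ l → L ℕ.≤ l → ∣ seq (s m) l - seq (s n) l ∣ ≤ ε
    near m n N≤m N≤n l L≤l with ℕ.≤-total m n
    ... | inj₁ m≤n = subst (_≤ ε) (∣p-q∣≡∣q-p∣ (seq (s n) l) (seq (s m) l))
      (≤-trans (dom l L≤l m n m≤n)
        (≤-trans (p≤∣p∣ (t n - t m)) (proj₂ (ct ε 0<ε) n m N≤n N≤m)))
    ... | inj₂ n≤m = ≤-trans (dom l L≤l n m n≤m)
        (≤-trans (p≤∣p∣ (t m - t n)) (proj₂ (ct ε 0<ε) m n N≤m N≤n))

open SumLemmas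

1/!_ : ℕ → ℚ
1/! k = (+ 1 / (k !)) {{k ℕ.!≢0}}

expTerm : ℝ → ℕ → ℝ
expTerm x k = x ^ k *ℝ fromℚ (1/! k)

expPartial : ℝ → ℕ → ℝ
expPartial x n = sum {n} (λ k → expTerm x (toℕ k))

module ExpLemmas where
  1/!-nonneg : ∀ k → 0ℚ ≤ 1/! k
  1/!-nonneg k = nonNegative⁻¹ (1/! k) {{normalize-nonNeg 1 (k !) {{k ℕ.!≢0}}}}

  1/!-suc : ∀ k → 1/! (suc k) * fromℕ (suc k) ≡ 1/! k
  1/!-suc k = begin-equality
    1/! suc k * fromℕ (suc k)                             ≡⟨ sym (*-identityʳ _) ⟩
    1/! suc k * fromℕ (suc k) * 1ℚ                        ≡⟨ cong (1/! suc k * fromℕ (suc k) *_) (sym (1/n*n (k !) {{k ℕ.!≢0}})) ⟩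
    1/! suc k * fromℕ (suc k) * (1/! k * fromℕ (k !))     ≡⟨ lemma (1/! suc k) (fromℕ (suc k)) (1/! k) (fromℕ (k !)) ⟩
    1/! suc k * (fromℕ (suc k) * fromℕ (k !)) * 1/! k     ≡⟨ cong (λ q → 1/! suc k * q * 1/! k) (sym (fromℕ-* (suc k) (k !))) ⟩
    1/! suc k * fromℕ (suc k !) * 1/! k                   ≡⟨ cong (_* 1/! k) (1/n*n (suc k !) {{suc k ℕ.!≢0}}) ⟩
    1ℚ * 1/! k                                            ≡⟨ *-identityˡ (1/! k) ⟩
    1/! k                                                 ∎
    where
    open ≤-Reasoning
    lemma : ∀ a b c d → a * b * (c * d) ≡ a * (b * d) * c
    lemma = solve-∀ ℚR

  ^-nonneg : ∀ b k → 0ℚ ≤ b → 0ℚ ≤ b ℚS.^ k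
  ^-nonneg b zero    0≤b = fromℕ-nonneg 1
  ^-nonneg b (suc k) 0≤b = *-nonneg 0≤b (^-nonneg b k 0≤b)

  ∣^∣≤ : ∀ q b k → ∣ q ∣ ≤ b → ∣ q ℚS.^ k ∣ ≤ b ℚS.^ k
  ∣^∣≤ q b zero    h = ≤-refl
  ∣^∣≤ q b (suc k) h = ∣∣-mono-* q (q ℚS.^ k) h (∣^∣≤ q b k h)

  term : ℚ → ℕ → ℚ
  term b k = b ℚS.^ k * 1/! k

  ∣term∣≤ : ∀ q b k → ∣ q ∣ ≤ b → ∣ term q k ∣ ≤ term b k
  ∣term∣≤ q b k h = ∣∣-mono-* (q ℚS.^ k) (1/! k) (∣^∣≤ q b k h)
    (≤-reflexive (0≤p⇒∣p∣≡p (1/!-nonneg k)))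

  halving-sum : ∀ d f → (∀ k → 0ℚ ≤ f k) → (∀ k → f (suc k) + f (suc k) ≤ f k) →
                Σ< d f ≤ f 0 + f 0
  halving-sum zero    f 0≤f h = +-nonneg (f 0) (f 0) (0≤f 0) (0≤f 0)
  halving-sum (suc d) f 0≤f h = +-monoʳ-≤ (f 0)
    (≤-trans (halving-sum d (f ∘ suc) (0≤f ∘ suc) (h ∘ suc)) (h 0))

  module ExpSeries (b : ℚ) (0<b : 0ℚ < b) where
    open ≤-Reasoning

    term-nonneg : ∀ k → 0ℚ ≤ term b k
    term-nonneg k = *-nonneg (^-nonneg b k (<⇒≤ 0<b)) (1/!-nonneg k)

    ratio : ∀ k → term b (suc k) * fromℕ (suc k) ≡ term b k * b
    ratio k = begin-equality
      b * b ℚS.^ k * 1/! suc k * fromℕ (suc k)      ≡⟨ lemma b (b ℚS.^ k) (1/! suc k) (fromℕ (suc k)) ⟩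
      b ℚS.^ k * (1/! suc k * fromℕ (suc k)) * b    ≡⟨ cong (λ q → b ℚS.^ k * q * b) (1/!-suc k) ⟩
      b ℚS.^ k * 1/! k * b                          ∎
      where
      lemma : ∀ b p i n → b * p * i * n ≡ p * (i * n) * b
      lemma = solve-∀ ℚR

    K : ℕ
    K = proj₁ (archimedean (b + b))

    halving : ∀ k → K ℕ.≤ k → term b (suc k) + term b (suc k) ≤ term b k
    halving k K≤k = *-cancelʳ-≤-pos b {{positive 0<b}} (begin
      (t + t) * b               ≡⟨ lemma t b ⟩
      t * (b + b)               ≤⟨ *-monoˡ-≤-nonNeg t {{nonNegative (term-nonneg (suc k))}}
                                     (≤-trans (proj₂ (archimedean (b + b)))
                                              (fromℕ-mono (ℕ.m≤n⇒m≤1+n K≤k))) ⟩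
      t * fromℕ (suc k)         ≡⟨ ratio k ⟩
      term b k * b              ∎)
      where
      t = term b (suc k)
      lemma : ∀ t b → (t + t) * b ≡ t * (b + b)
      lemma = solve-∀ ℚR

    decreasing : ∀ j → term b (j ℕ.+ K) ≤ term b K
    decreasing zero    = ≤-refl
    decreasing (suc j) = begin
      t               ≡⟨ sym (+-identityʳ t) ⟩
      t + 0ℚ          ≤⟨ +-monoʳ-≤ t (term-nonneg (suc j ℕ.+ K)) ⟩
      t + t           ≤⟨ halving (j ℕ.+ K) (ℕ.m≤n+m K j) ⟩
      term b (j ℕ.+ K)  ≤⟨ decreasing j ⟩
      term b K        ∎
      where t = term b (suc j ℕ.+ K)

    small : ∀ {η} → 0ℚ < η → ∃ λ N → ∀ m → N ℕ.≤ m → term b m ≤ η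
    small {η} 0<η = suc (K ℕ.⊔ N) , go
      where
      N = proj₁ (archimedean-* (term b K * b) 0<η)
      go : ∀ m → suc (K ℕ.⊔ N) ℕ.≤ m → term b m ≤ η
      go (suc k) (ℕ.s≤s le) = *-cancelʳ-≤-pos (fromℕ (suc k)) {{positive (fromℕ-pos k)}} (begin
        term b (suc k) * fromℕ (suc k)   ≡⟨ ratio k ⟩
        term b k * b                     ≡⟨ cong (λ i → term b i * b) (sym (ℕ.m∸n+n≡m (ℕ.m⊔n≤o⇒m≤o K N le))) ⟩
        term b ((k ℕ.∸ K) ℕ.+ K) * b     ≤⟨ *-monoʳ-≤-nonNeg b {{nonNegative (<⇒≤ 0<b)}} (decreasing (k ℕ.∸ K)) ⟩
        term b K * b                     ≤⟨ proj₂ (archimedean-* (term b K * b) 0<η) (suc k)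
                                              (ℕ.m≤n⇒m≤1+n (ℕ.m⊔n≤o⇒n≤o K N le)) ⟩
        fromℕ (suc k) * η                ≡⟨ *-comm (fromℕ (suc k)) η ⟩
        η * fromℕ (suc k)                ∎)

    partial-cauchy : IsCauchy (λ n → Σ< n (term b))
    partial-cauchy = ordered-cauchy (λ n → Σ< n (term b)) λ ε 0<ε →
      let N , sm = small (half-pos 0<ε) in
      K ℕ.⊔ N , λ m n KN≤m m≤n →
      let K≤m = ℕ.m⊔n≤o⇒m≤o K N KN≤m
          f = λ j → term b (m ℕ.+ j)
          d = n ℕ.∸ m
          tm≤ : f 0 ≤ half ε
          tm≤ = subst (λ i → term b i ≤ half ε) (sym (ℕ.+-identityʳ m)) (sm m (ℕ.m⊔n≤o⇒n≤o K N KN≤m))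
      in begin
      ∣ Σ< n (term b) - Σ< m (term b) ∣   ≡⟨ cong ∣_∣ (Σ<-tail m n (term b) m≤n) ⟩
      ∣ Σ< d f ∣                          ≤⟨ ∣sum∣≤ {d} (f ∘ toℕ) (f ∘ toℕ) (λ j →
                                              ≤-reflexive (0≤p⇒∣p∣≡p (term-nonneg (m ℕ.+ toℕ j)))) ⟩
      Σ< d f                              ≤⟨ halving-sum d f (λ j → term-nonneg (m ℕ.+ j)) (λ j →
                                              subst (λ i → term b i + term b i ≤ f j) (sym (ℕ.+-suc m j))
                                                (halving (m ℕ.+ j) (ℕ.≤-trans K≤m (ℕ.m≤m+n m j)))) ⟩
      f 0 + f 0                           ≤⟨ +-mono-≤ tm≤ tm≤ ⟩
      half ε + half ε                     ≡⟨ half+half ε ⟩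
      ε                                   ∎

  seq-expTerm : ∀ x k l → seq (expTerm x k) l ≡ term (seq x l) k
  seq-expTerm x k l = cong (_* 1/! k) (seq-^ x k l)

  opaque
    expPartial-cauchy : ∀ x → IsCauchyℝ (expPartial x)
    expPartial-cauchy x =
      let B , 0<B , L , h = bounded (seq x) (cauchy x) in
      dominated (expPartial x) (λ n → Σ< n (term B)) (ExpSeries.partial-cauchy B 0<B)
        (L , λ l L≤l m n m≤n → subst₂ (λ p q → ∣ p - q ∣ ≤ Σ< n (term B) - Σ< m (term B))
          (sym (seq-sum {n} _ l)) (sym (seq-sum {m} _ l))
          (Σ<-diff m n (λ k → seq (expTerm x k) l) (term B)
            (λ k → subst (λ q → ∣ q ∣ ≤ term B k) (sym (seq-expTerm x k l))
              (∣term∣≤ (seq x l) B k (h l L≤l))) m≤n))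

open ExpLemmas

exp : ℝ → ℝ
exp x = lim (expPartial x) (expPartial-cauchy x)

poisson : ℝ → ℕ → ℝ
poisson μ k = exp (-ℝ μ) *ℝ expTerm μ k

-- Probability that, for every i, exactly lookup c i vertices of type i
-- arrive in [0,1].
likelihood : ∀ {m} → (Fin m → ℝ) → Vec ℕ m → ℝ
likelihood rate c = product (λ i → poisson (rate i) (Vec.lookup c i))

-- The sum of g over {0,…,N-1}^m.
boxSum : ℕ → ∀ {m} → (Vec ℕ m → ℝ) → ℝ
boxSum N {zero}  g = g []
boxSum N {suc m} g = sum {N} (λ k → boxSum N (λ c → g (toℕ k ∷ c)))

partialExpectation : ∀ {m} → (Fin m → ℝ) → (Vec ℕ m → ℝ) → ℕ → ℝ
partialExpectation rate f N = boxSum N (λ c → likelihood rate c *ℝ f c)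

UniformlyBounded : ∀ {a} {A : Set a} → (A → ℝ) → Set a
UniformlyBounded {A = A} f =
  ∃ λ B → 0ℚ < B × ∃ λ L → ∀ (a : A) l → L ℕ.≤ l → ∣ seq (f a) l ∣ ≤ B

module ExpectationLemmas where
  Fin-bounded : ∀ {m} (f : Fin m → ℝ) → UniformlyBounded f
  Fin-bounded {zero}  f = 1ℚ , fromℕ-pos 0 , 0 , λ ()
  Fin-bounded {suc m} f =
    let B , 0<B , K , h = bounded (seq (f zero)) (cauchy (f zero))
        C , 0<C , L , t = Fin-bounded (f ∘ suc)
    in B ⊔ C , <-≤-trans 0<B (p≤p⊔q B C) , K ℕ.⊔ L , λ
      { zero    l le → ≤-trans (h l (ℕ.m⊔n≤o⇒m≤o K L le)) (p≤p⊔q B C)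
      ; (suc i) l le → ≤-trans (t i l (ℕ.m⊔n≤o⇒n≤o K L le)) (p≤q⊔p B C) }

  Fin²-bounded : ∀ {m n} (f : Fin m → Fin n → ℝ) →
                 UniformlyBounded (λ (ij : Fin m × Fin n) → f (proj₁ ij) (proj₂ ij))
  Fin²-bounded {zero}  f = 1ℚ , fromℕ-pos 0 , 0 , λ { (() , _) }
  Fin²-bounded {suc m} f =
    let B , 0<B , K , h = Fin-bounded (f zero)
        C , 0<C , L , t = Fin²-bounded (f ∘ suc)
    in B ⊔ C , <-≤-trans 0<B (p≤p⊔q B C) , K ℕ.⊔ L , λ
      { (zero , j)  l le → ≤-trans (h j l (ℕ.m⊔n≤o⇒m≤o K L le)) (p≤p⊔q B C)
      ; (suc i , j) l le → ≤-trans (t (i , j) l (ℕ.m⊔n≤o⇒n≤o K L le)) (p≤q⊔p B C) }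

  boxSumℚ : ℕ → ∀ {m} → (Vec ℕ m → ℚ) → ℚ
  boxSumℚ N {zero}  g = g []
  boxSumℚ N {suc m} g = Σ< N (λ k → boxSumℚ N (λ c → g (k ∷ c)))

  sum-cong : ∀ {n} {f g : Fin n → ℚ} → (∀ i → f i ≡ g i) → ℚS.sum f ≡ ℚS.sum g
  sum-cong {zero}  h = refl
  sum-cong {suc n} h = cong₂ _+_ (h zero) (sum-cong (h ∘ suc))

  seq-boxSum : ∀ N {m} (g : Vec ℕ m → ℝ) l → seq (boxSum N g) l ≡ boxSumℚ N (λ c → seq (g c) l)
  seq-boxSum N {zero}  g l = refl
  seq-boxSum N {suc m} g l = trans (seq-sum {N} _ l)
    (sum-cong {N} (λ k → seq-boxSum N (λ c → g (toℕ k ∷ c)) l))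

  module BoxBound (b : ℕ → ℚ) where
    open ≤-Reasoning

    bs : ∀ {m} → Vec ℕ m → ℚ
    bs []      = 1ℚ
    bs (k ∷ c) = b k * bs c

    S : ℕ → ℚ
    S N = Σ< N b

    regroup : ∀ k {m} (c : Vec ℕ m) C → bs (k ∷ c) * C ≡ bs c * (b k * C)
    regroup k c C = lemma (b k) (bs c) C
      where
      lemma : ∀ x y z → x * y * z ≡ y * (x * z)
      lemma = solve-∀ ℚR

    slice : ∀ {m} {h : Vec ℕ (suc m) → ℚ} {C} → (∀ c → ∣ h c ∣ ≤ bs c * C) →
            ∀ k c → ∣ h (k ∷ c) ∣ ≤ bs c * (b k * C)
    slice {h = h} {C} le k c = subst (∣ h (k ∷ c) ∣ ≤_) (regroup k c C) (le (k ∷ c))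

    swap : ∀ x y z → x * (y * z) ≡ y * (x * z)
    swap = solve-∀ ℚR

    box≤ : ∀ N {m} (h : Vec ℕ m → ℚ) C → (∀ c → ∣ h c ∣ ≤ bs c * C) →
           ∣ boxSumℚ N h ∣ ≤ S N ℚS.^ m * C
    box≤ N {zero}  h C le = le []
    box≤ N {suc m} h C le = begin
      ∣ boxSumℚ N h ∣                       ≤⟨ ∣sum∣≤ {N} _ _ (λ k →
                                                box≤ N (λ c → h (toℕ k ∷ c)) (b (toℕ k) * C) (slice le (toℕ k))) ⟩
      Σ< N (λ k → S N ℚS.^ m * (b k * C))   ≡⟨ sum-cong {N} (λ k → swap (S N ℚS.^ m) (b (toℕ k)) C) ⟩
      Σ< N (λ k → b k * (S N ℚS.^ m * C))   ≡⟨ Σ<-* N b (S N ℚS.^ m * C) ⟩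
      S N * (S N ℚS.^ m * C)                ≡⟨ sym (*-assoc (S N) (S N ℚS.^ m) C) ⟩
      S N * S N ℚS.^ m * C                  ∎

    box-diff : ∀ M N → M ℕ.≤ N → ∀ {m} (h : Vec ℕ m → ℚ) C → (∀ c → ∣ h c ∣ ≤ bs c * C) →
               ∣ boxSumℚ N h - boxSumℚ M h ∣ ≤ (S N ℚS.^ m - S M ℚS.^ m) * C
    box-diff M N M≤N {zero} h C le = ≤-reflexive
      (trans (cong ∣_∣ (+-inverseʳ (h []))) (sym (*-zeroˡ C)))
    box-diff M N M≤N {suc m} h C le = begin
      ∣ Σ< N (G N) - Σ< M (G M) ∣
        ≡⟨ cong ∣_∣ (telescope (Σ< N (G N)) (Σ< M (G N)) (Σ< M (G M))) ⟩
      ∣ (Σ< N (G N) - Σ< M (G N)) + (Σ< M (G N) - Σ< M (G M)) ∣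
        ≤⟨ ∣∣-mono-+ (Σ< N (G N) - Σ< M (G N)) (Σ< M (G N) - Σ< M (G M)) outer inner ⟩
      (S N * (P N * C) - S M * (P N * C)) + S M * ((P N - P M) * C)
        ≡⟨ collect (S N) (S M) (P N) (P M) C ⟩
      (S N * P N - S M * P M) * C ∎
      where
      G : ℕ → ℕ → ℚ
      G R k = boxSumℚ R (λ c → h (k ∷ c))
      P : ℕ → ℚ
      P R = S R ℚS.^ m

      telescope : ∀ x y z → x - z ≡ (x - y) + (y - z)
      telescope = solve-∀ ℚR
      collect : ∀ s t p q c → (s * (p * c) - t * (p * c)) + t * ((p - q) * c) ≡ (s * p - t * q) * c
      collect = solve-∀ ℚR

      outer : ∣ Σ< N (G N) - Σ< M (G N) ∣ ≤ S N * (P N * C) - S M * (P N * C)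
      outer = subst (∣ Σ< N (G N) - Σ< M (G N) ∣ ≤_)
        (cong₂ _-_ (Σ<-* N b (P N * C)) (Σ<-* M b (P N * C)))
        (Σ<-diff M N (G N) (λ k → b k * (P N * C)) (λ k →
          subst (∣ G N k ∣ ≤_) (swap (P N) (b k) C)
            (box≤ N (λ c → h (k ∷ c)) (b k * C) (slice le k))) M≤N)

      inner : ∣ Σ< M (G N) - Σ< M (G M) ∣ ≤ S M * ((P N - P M) * C)
      inner = subst₂ _≤_ (cong ∣_∣ (Σ<-minus M (G N) (G M))) (Σ<-* M b ((P N - P M) * C))
        (∣sum∣≤ {M} _ _ (λ k →
          subst (∣ G N (toℕ k) - G M (toℕ k) ∣ ≤_) (swap (P N - P M) (b (toℕ k)) C)
            (box-diff M N M≤N (λ c → h (toℕ k ∷ c)) (b (toℕ k) * C) (slice le (toℕ k)))))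

  pow-cauchy : ∀ s m → IsCauchy s → IsCauchy (λ n → s n ℚS.^ m)
  pow-cauchy s zero    cs = const-cauchy 1ℚ
  pow-cauchy s (suc m) cs = *-cauchy s (λ n → s n ℚS.^ m) cs (pow-cauchy s m cs)

  ∣product∣≤ : ∀ {m} (p : Fin m → ℕ → ℝ) (b : ℕ → ℚ) l →
               (∀ i k → ∣ seq (p i k) l ∣ ≤ b k) →
               ∀ c → ∣ seq (product (λ i → p i (Vec.lookup c i))) l ∣ ≤ BoxBound.bs b c
  ∣product∣≤ p b l h []      = ≤-refl
  ∣product∣≤ p b l h (k ∷ c) = ∣∣-mono-* (seq (p zero k) l)
    (seq (product (λ i → p (suc i) (Vec.lookup c i))) l)
    (h zero k) (∣product∣≤ (p ∘ suc) b l (h ∘ suc) c)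

  opaque
    partialExpectation-cauchy : ∀ {m} (rate : Fin m → ℝ) (f : Vec ℕ m → ℝ) →
                                UniformlyBounded f → IsCauchyℝ (partialExpectation rate f)
    partialExpectation-cauchy {m} rate f (W , 0<W , L₁ , hW) =
      let E , 0<E , L₂ , hE = Fin-bounded (λ i → exp (-ℝ rate i))
          B , 0<B , L₃ , hB = Fin-bounded rate
          b : ℕ → ℚ
          b k = term B k * E
          open BoxBound b
          S-cauchy : IsCauchy S
          S-cauchy = cauchy-cong (λ n → sym (Σ<-* n (term B) E))
            (*-cauchy (λ n → Σ< n (term B)) (λ _ → E) (ExpSeries.partial-cauchy B 0<B) (const-cauchy E))
          L = (L₁ ℕ.⊔ L₂) ℕ.⊔ L₃
          poisson≤ : ∀ l → L ℕ.≤ l → ∀ i k → ∣ seq (poisson (rate i) k) l ∣ ≤ b k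
          poisson≤ l L≤l i k = subst (∣ seq (poisson (rate i) k) l ∣ ≤_) (*-comm E (term B k))
            (∣∣-mono-* (seq (exp (-ℝ rate i)) l) (seq (expTerm (rate i) k) l)
              (hE i l (ℕ.m⊔n≤o⇒n≤o L₁ L₂ (ℕ.m⊔n≤o⇒m≤o (L₁ ℕ.⊔ L₂) L₃ L≤l)))
              (subst (λ q → ∣ q ∣ ≤ term B k) (sym (seq-expTerm (rate i) k l))
                (∣term∣≤ (seq (rate i) l) B k (hB i l (ℕ.m⊔n≤o⇒n≤o (L₁ ℕ.⊔ L₂) L₃ L≤l)))))
      in dominated (partialExpectation rate f) (λ N → S N ℚS.^ m * W)
        (*-cauchy (λ N → S N ℚS.^ m) (λ _ → W) (pow-cauchy S m S-cauchy) (const-cauchy W))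
        (L , λ l L≤l M N M≤N →
          let g = λ c → likelihood rate c *ℝ f c in
          subst₂ (λ p q → ∣ p - q ∣ ≤ S N ℚS.^ m * W - S M ℚS.^ m * W)
            (sym (seq-boxSum N g l)) (sym (seq-boxSum M g l))
            (subst (∣ boxSumℚ N (λ c → seq (g c) l) - boxSumℚ M (λ c → seq (g c) l) ∣ ≤_)
              (distrib (S N ℚS.^ m) (S M ℚS.^ m) W)
              (box-diff M N M≤N (λ c → seq (g c) l) W (λ c →
                ∣∣-mono-* (seq (likelihood rate c) l) (seq (f c) l)
                  (∣product∣≤ (poisson ∘ rate) b l (poisson≤ l L≤l) c)
                  (hW c l (ℕ.m⊔n≤o⇒m≤o L₁ L₂ (ℕ.m⊔n≤o⇒m≤o (L₁ ℕ.⊔ L₂) L₃ L≤l)))))))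
      where
      distrib : ∀ p q c → (p - q) * c ≡ p * c - q * c
      distrib = solve-∀ ℚR

open ExpectationLemmas

-- The series over ℕ^m converges absolutely, so summing it along growing
-- boxes gives its value.
expectation : ∀ {m} → (Fin m → ℝ) → (f : Vec ℕ m → ℝ) → UniformlyBounded f → ℝ
expectation rate f bdd =
  lim (partialExpectation rate f) (partialExpectation-cauchy rate f bdd)

-- A matching of N online with n offline vertices, stored as the partner,
-- if any, of every offline vertex.
PartnerMap : ℕ → ℕ → Set
PartnerMap N n = Vec (Maybe (Fin N)) n

IsMatching : ∀ {N n} → PartnerMap N n → Set
IsMatching M = ∀ j k v → Vec.lookup M j ≡ just v → Vec.lookup M k ≡ just v → j ≡ k

isMatching? : ∀ {N n} (M : PartnerMap N n) → Dec (IsMatching M)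
isMatching? M = Fin.all? λ j → Fin.all? λ k → Fin.all? λ v →
  Maybe.≡-dec Fin._≟_ (Vec.lookup M j) (just v) →-dec
  (Maybe.≡-dec Fin._≟_ (Vec.lookup M k) (just v) →-dec (j Fin.≟ k))

allVecs : ∀ {A : Set} → List A → ∀ n → List (Vec A n)
allVecs xs zero    = [] ∷ []
allVecs xs (suc n) = List.cartesianProductWith _∷_ xs (allVecs xs n)

matchings : ∀ N n → List (PartnerMap N n)
matchings N n = List.filter isMatching? (allVecs (nothing ∷ List.map just (List.allFin N)) n)

weight : ∀ {N n} → (Fin N → Fin n → ℝ) → PartnerMap N n → ℝ
weight u M = sum (λ j → maybe (λ v → u v j) 0ℝ (Vec.lookup M j))

-- The base value 0ℝ is the weight of the empty matching.
maxWeight : ∀ {N n} → (Fin N → Fin n → ℝ) → ℝ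
maxWeight {N} {n} u = List.foldr _⊔ℝ_ 0ℝ (List.map (weight u) (matchings N n))

-- The types of the arriving vertices when lookup c i of them have type i;
-- their order has no influence on the maximum weight.
arrivals : ∀ {m} → Vec ℕ m → List (Fin m)
arrivals c = List.concat (List.tabulate (λ i → List.replicate (Vec.lookup c i) i))

hindsightOptimum : ∀ {m n} → (Fin m → Fin n → ℝ) → Vec ℕ m → ℝ
hindsightOptimum w c = maxWeight (λ v → w (List.lookup (arrivals c) v))

module MatchingLemmas where
  ∣⊔∣≤ : ∀ p q {B} → ∣ p ∣ ≤ B → ∣ q ∣ ≤ B → ∣ p ⊔ q ∣ ≤ B
  ∣⊔∣≤ p q {B} p≤ q≤ with ⊔-sel p q
  ... | inj₁ eq = subst (λ r → ∣ r ∣ ≤ B) (sym eq) p≤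
  ... | inj₂ eq = subst (λ r → ∣ r ∣ ≤ B) (sym eq) q≤

  ∣weight∣≤ : ∀ {N n} (u : Fin N → Fin n → ℝ) l W → 0ℚ < W →
              (∀ v j → ∣ seq (u v j) l ∣ ≤ W) →
              ∀ M → ∣ seq (weight u M) l ∣ ≤ ℚS.sum {n} (λ _ → W)
  ∣weight∣≤ {N} {n} u l W 0<W h M = subst (λ q → ∣ q ∣ ≤ ℚS.sum {n} (λ _ → W))
    (sym (seq-sum (λ j → partner j (Vec.lookup M j)) l))
    (∣sum∣≤ {n} (λ j → seq (partner j (Vec.lookup M j)) l) (λ _ → W) (λ j → edge j (Vec.lookup M j)))
    where
    partner : Fin n → Maybe (Fin N) → ℝ
    partner j = maybe (λ v → u v j) 0ℝ
    edge : ∀ j p → ∣ seq (partner j p) l ∣ ≤ W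
    edge j nothing  = <⇒≤ 0<W
    edge j (just v) = h v j

  ∣foldr∣≤ : ∀ {A : Set} (f : A → ℝ) l {B} → 0ℚ ≤ B → (∀ a → ∣ seq (f a) l ∣ ≤ B) →
             ∀ as → ∣ seq (List.foldr _⊔ℝ_ 0ℝ (List.map f as)) l ∣ ≤ B
  ∣foldr∣≤ f l 0≤B h []       = 0≤B
  ∣foldr∣≤ f l 0≤B h (a ∷ as) = ∣⊔∣≤ (seq (f a) l)
    (seq (List.foldr _⊔ℝ_ 0ℝ (List.map f as)) l) (h a) (∣foldr∣≤ f l 0≤B h as)

open MatchingLemmas

opaque
  hindsightOptimum-bounded : ∀ {m n} (w : Fin m → Fin n → ℝ) → UniformlyBounded (hindsightOptimum w)
  hindsightOptimum-bounded {m} {n} w =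
    let W , 0<W , L , h = Fin²-bounded w
        B = ℚS.sum {n} (λ _ → W)
        0≤B : 0ℚ ≤ B
        0≤B = ≤-trans (0≤∣p∣ _) (∣sum∣≤ {n} (λ _ → 0ℚ) (λ _ → W) (λ _ → <⇒≤ 0<W))
    in 1ℚ + B , +-mono-<-≤ (fromℕ-pos 0) 0≤B , L , λ c l L≤l →
      let u = λ v → w (List.lookup (arrivals c) v) in
      ≤-trans
        (∣foldr∣≤ (weight u) l 0≤B (∣weight∣≤ u l W 0<W (λ v j → h (List.lookup (arrivals c) v , j) l L≤l))
          (matchings (List.length (arrivals c)) n))
        (subst (_≤ 1ℚ + B) (+-identityˡ B) (+-monoˡ-≤ B (fromℕ-nonneg 1)))

OPT : ∀ {m n} → (Fin m → Fin n → ℝ) → (Fin m → ℝ) → ℝ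
OPT w rate = expectation rate (hindsightOptimum w) (hindsightOptimum-bounded w)

sumOver : ∀ {m} → Subset m → (Fin m → ℝ) → ℝ
sumOver S f = sum (λ i → if Vec.lookup S i then f i else 0ℝ)

record Feasible {m n} (rate : Fin m → ℝ) (x : Fin m → Fin n → ℝ) : Set where
  field
    capacity : ∀ i → sum (x i) ≤ℝ rate i
    arrival  : ∀ j (S : Subset m) →
                sumOver S (λ i → x i j) ≤ℝ 1ℝ +ℝ -ℝ exp (-ℝ sumOver S rate)
    nonneg   : ∀ i j → 0ℝ ≤ℝ x i j

objective : ∀ {m n} → (Fin m → Fin n → ℝ) → (Fin m → Fin n → ℝ) → ℝ
objective w x = sum (λ i → sum (λ j → w i j *ℝ x i j))

-- v is the optimal value of the program, i.e. the supremum of the objective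
-- over the feasible points; no optimal solution has to be exhibited.
record IsNAT {m n} (w : Fin m → Fin n → ℝ) (rate : Fin m → ℝ) (v : ℝ) : Set where
  field
    upperBound : ∀ x → Feasible rate x → objective w x ≤ℝ v
    approached : ∀ ε → 0ℚ < ε → ∃ λ x → Feasible rate x × v ≤ℝ objective w x +ℝ fromℚ ε

{-# OPTIONS --safe #-}
module Submission where

-- For every arrival vector c fix a nearly maximum matching, and let x i j be
-- the expected number of type-i vertices matched to j, the expectation being
-- cut off at a large box. This x is feasible: a matching uses type i at most
-- c i times, and the mean of c i is rate i; a vertex j has at most one partner,
-- whose type lies in S only if some type in S arrives. The objective at x is
-- the expected weight of the chosen matchings, so it is almost OPT.
-- Cutting off at the box keeps x a finite sum and only lowers the left-hand
-- sides of the constraints.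

open import Defs
open import Algebra.Bundles using (CommutativeRing)
open import Data.Bool.Base using (Bool; true; false; if_then_else_)
open import Data.Fin.Base using (Fin; zero; suc; toℕ)
import Data.Fin.Properties as Fin
open import Data.Fin.Subset using (Subset)
import Data.Integer.Base as ℤ
open import Data.List.Base as List using (List; []; _∷_; _++_)
open import Data.List.Relation.Unary.All using (All; []; _∷_)
import Data.List.Relation.Unary.All.Properties as All
open import Data.Maybe.Base as Maybe using (Maybe; nothing; just; maybe)
import Data.Maybe.Properties as Maybe
open import Data.Nat.Base as ℕ using (ℕ; zero; suc)
import Data.Nat.Properties as ℕ
open import Data.Product.Base using (∃; _×_; _,_; proj₁; proj₂)
open import Data.Rational.Base
open import Data.Rational.Properties
open import Data.Sum.Base as Sum using (_⊎_; inj₁; inj₂)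
open import Data.Vec.Base as Vec using (Vec; []; _∷_)
import Data.Vec.Properties as Vec
open import Function.Base using (_∘_)
open import Relation.Binary.PropositionalEquality
open import Relation.Nullary using (yes; no; contradiction)
open import Tactic.RingSolver using (solve-∀)

import Algebra.Definitions.RawSemiring +-*-rawSemiring as ℚS
open import Algebra.Properties.Semiring.Sum (CommutativeRing.semiring +-*-commutativeRing)
  using (∑-distrib-+; ∑-comm; *-distribˡ-sum)

open ℚ-Ring
open ℚ-Lemmas
open Cauchy
open SumLemmas
open ExpLemmas
open ExpectationLemmas

-- The order on `ℝ` cannot be decided, so a maximum weight matching cannot be picked out; one within
-- `ε` of the maximum can, and arrival vectors are discrete, so the choice is made for each of them
-- separately. The box has a second reason: `expectation` asks for a uniformly bounded function, and
-- the counts `c i`, whose mean the capacity constraint needs, are unbounded. On a box all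
-- interchanges of sums are finite, and its mass is at most 1, which suffices for upper bounds. The
-- analytic obstacle is that the program has `1 - exp (- Σ λ)` for a whole subset, whereas the
-- likelihood is a product of single Poisson factors. Reconciling them takes exp (x + y) = exp x *
-- exp y for exp given as a limit of partial sums: a product of two partial sums is a square of
-- terms, a partial sum of exp (x + y) is a triangle of the same terms, and the difference is small.
-- The same equation yields exp ≥ 0 and exp (- μ) * exp μ ≤ 1, hence nonnegative likelihoods and
-- mass at most 1.

-- Finite sums of rationals

sum-mono : ∀ {n} {f g : Fin n → ℚ} → (∀ i → f i ≤ g i) → ℚS.sum f ≤ ℚS.sum g
sum-mono {zero}  le = ≤-refl
sum-mono {suc n} le = +-mono-≤ (le zero) (sum-mono (le ∘ suc))

sum-zero : ∀ {n} {f : Fin n → ℚ} → (∀ i → f i ≡ 0ℚ) → ℚS.sum f ≡ 0ℚ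
sum-zero {zero}  eq = refl
sum-zero {suc n} eq = cong₂ _+_ (eq zero) (sum-zero (eq ∘ suc))

sum-nonneg : ∀ {n} {f : Fin n → ℚ} → (∀ i → 0ℚ ≤ f i) → 0ℚ ≤ ℚS.sum f
sum-nonneg {n} {f} 0≤f = ≤-trans (≤-reflexive (sym (sum-zero {n} (λ _ → refl)))) (sum-mono 0≤f)

summand≤sum : ∀ {n} {f : Fin n → ℚ} → (∀ i → 0ℚ ≤ f i) → ∀ i → f i ≤ ℚS.sum f
summand≤sum {suc n} {f} 0≤f zero = ≤-trans (≤-reflexive (sym (+-identityʳ (f zero))))
  (+-monoʳ-≤ (f zero) (sum-nonneg (0≤f ∘ suc)))
summand≤sum {suc n} {f} 0≤f (suc i) = ≤-trans (summand≤sum (0≤f ∘ suc) i)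
  (≤-trans (≤-reflexive (sym (+-identityˡ _))) (+-monoˡ-≤ _ (0≤f zero)))

-- Cauchy products of exponential series

Σ<-snoc : ∀ n f → Σ< (suc n) f ≡ Σ< n f + f n
Σ<-snoc zero    f = +-comm (f 0) 0ℚ
Σ<-snoc (suc n) f = trans (cong (λ q → f 0 + q) (Σ<-snoc n (f ∘ suc)))
  (sym (+-assoc (f 0) (Σ< n (f ∘ suc)) (f (suc n))))

Σ<-nonneg : ∀ n f → (∀ k → 0ℚ ≤ f k) → 0ℚ ≤ Σ< n f
Σ<-nonneg n f 0≤f = sum-nonneg {n} (0≤f ∘ toℕ)

Σ<-extend : ∀ {m n} f → (∀ k → 0ℚ ≤ f k) → m ℕ.≤ n → Σ< m f ≤ Σ< n f
Σ<-extend {n = n} f 0≤f ℕ.z≤n    = Σ<-nonneg n f 0≤f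
Σ<-extend         f 0≤f (ℕ.s≤s le) = +-monoʳ-≤ (f 0) (Σ<-extend (f ∘ suc) (0≤f ∘ suc) le)

-- The sum of h i j over i + j = n.
diag : (ℕ → ℕ → ℚ) → ℕ → ℚ
diag h zero    = h 0 0
diag h (suc n) = h 0 (suc n) + diag (h ∘ suc) n

diag-snoc : ∀ n h → diag h (suc n) ≡ diag (λ i j → h i (suc j)) n + h (suc n) 0
diag-snoc zero    h = refl
diag-snoc (suc n) h = trans (cong (λ q → h 0 (suc (suc n)) + q) (diag-snoc n (h ∘ suc)))
  (sym (+-assoc (h 0 (suc (suc n))) (diag (λ i j → h (suc i) (suc j)) n) (h (suc (suc n)) 0)))

diag-cong : ∀ n {h k} → (∀ i j → h i j ≡ k i j) → diag h n ≡ diag k n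
diag-cong zero    eq = eq 0 0
diag-cong (suc n) eq = cong₂ _+_ (eq 0 (suc n)) (diag-cong n (eq ∘ suc))

diag-* : ∀ n h c → diag (λ i j → h i j * c) n ≡ diag h n * c
diag-* zero    h c = refl
diag-* (suc n) h c = trans (cong (λ q → h 0 (suc n) * c + q) (diag-* n (h ∘ suc) c))
  (sym (*-distribʳ-+ c (h 0 (suc n)) (diag (h ∘ suc) n)))

diag-+ : ∀ n h k → diag (λ i j → h i j + k i j) n ≡ diag h n + diag k n
diag-+ zero    h k = refl
diag-+ (suc n) h k = trans (cong (λ q → h 0 (suc n) + k 0 (suc n) + q) (diag-+ n (h ∘ suc) (k ∘ suc)))
  (lemma (h 0 (suc n)) (k 0 (suc n)) (diag (h ∘ suc) n) (diag (k ∘ suc) n))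
  where
  lemma : ∀ a b c d → a + b + (c + d) ≡ (a + c) + (b + d)
  lemma = solve-∀ ℚR

-- On the diagonal `i + j` is constantly `n`. The offset `a` carries the induction: passing to
-- `h ∘ suc` moves one unit from `i` into it.
diag-degree : ∀ n a h → diag (λ i j → h i j * (a + (fromℕ i + fromℕ j))) n ≡ diag h n * (a + fromℕ n)
diag-degree zero    a h = refl
diag-degree (suc n) a h = begin
  h 0 (suc n) * (a + (0ℚ + fromℕ (suc n))) + diag (λ i j → h (suc i) j * (a + (fromℕ (suc i) + fromℕ j))) n
    ≡⟨ cong₂ _+_ (cong (λ q → h 0 (suc n) * (a + q)) (+-identityˡ (fromℕ (suc n))))
        (trans (diag-cong n (λ i j → lemma (h (suc i) j) a 1ℚ (fromℕ i) (fromℕ j)))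
               (diag-degree n (a + 1ℚ) (h ∘ suc))) ⟩
  h 0 (suc n) * (a + (1ℚ + fromℕ n)) + diag (h ∘ suc) n * (a + 1ℚ + fromℕ n)
    ≡⟨ collect (h 0 (suc n)) (diag (h ∘ suc) n) a 1ℚ (fromℕ n) ⟩
  (h 0 (suc n) + diag (h ∘ suc) n) * (a + (1ℚ + fromℕ n)) ∎
  where
  open ≡-Reasoning
  lemma : ∀ h a u i j → h * (a + (u + i + j)) ≡ h * (a + u + (i + j))
  lemma = solve-∀ ℚR
  collect : ∀ x y a u n → x * (a + (u + n)) + y * (a + u + n) ≡ (x + y) * (a + (u + n))
  collect = solve-∀ ℚR

term-suc : ∀ q k → term q (suc k) * fromℕ (suc k) ≡ term q k * q
term-suc q k = trans (lemma q (q ℚS.^ k) (1/! suc k) (fromℕ (suc k)))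
  (cong (λ r → q ℚS.^ k * r * q) (1/!-suc k))
  where
  lemma : ∀ b p i n → b * p * i * n ≡ p * (i * n) * b
  lemma = solve-∀ ℚR

-- The binomial theorem divided by n!, without binomial coefficients. After multiplication by
-- `suc n`, which is `i + j`, each entry splits into an `i` share and a `j` share; `term-suc` lowers
-- the degree of one factor and releases a `q` or an `r`, so the induction hypothesis leaves
-- `term (q + r) n * (q + r)`.
diag-term : ∀ q r n → diag (λ i j → term q i * term r j) n ≡ term (q + r) n
diag-term q r zero    = refl
diag-term q r (suc n) = *-cancelʳ (fromℕ-pos n) (begin
  diag h (suc n) * fromℕ (suc n)
    ≡⟨ cong (λ x → diag h (suc n) * x) (sym (+-identityˡ (fromℕ (suc n)))) ⟩
  diag h (suc n) * (0ℚ + fromℕ (suc n))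
    ≡⟨ sym (diag-degree (suc n) 0ℚ h) ⟩
  diag (λ i j → h i j * (0ℚ + (fromℕ i + fromℕ j))) (suc n)
    ≡⟨ diag-cong (suc n) (λ i j → split (term q i) (term r j) (fromℕ i) (fromℕ j)) ⟩
  diag (λ i j → term q i * fromℕ i * term r j + term q i * (term r j * fromℕ j)) (suc n)
    ≡⟨ diag-+ (suc n) (λ i j → term q i * fromℕ i * term r j) (λ i j → term q i * (term r j * fromℕ j)) ⟩
  diag (λ i j → term q i * fromℕ i * term r j) (suc n) + diag (λ i j → term q i * (term r j * fromℕ j)) (suc n)
    ≡⟨ cong₂ _+_ left right ⟩
  diag h n * q + diag h n * r
    ≡⟨ cong (λ x → x * q + x * r) (diag-term q r n) ⟩
  term (q + r) n * q + term (q + r) n * r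
    ≡⟨ sym (*-distribˡ-+ (term (q + r) n) q r) ⟩
  term (q + r) n * (q + r)
    ≡⟨ sym (term-suc (q + r) n) ⟩
  term (q + r) (suc n) * fromℕ (suc n) ∎)
  where
  open ≡-Reasoning
  h : ℕ → ℕ → ℚ
  h i j = term q i * term r j
  *-cancelʳ : ∀ {a b c} → 0ℚ < c → a * c ≡ b * c → a ≡ b
  *-cancelʳ {c = c} 0<c eq = ≤-antisym
    (*-cancelʳ-≤-pos c {{positive 0<c}} (≤-reflexive eq))
    (*-cancelʳ-≤-pos c {{positive 0<c}} (≤-reflexive (sym eq)))
  split : ∀ a b i j → a * b * (0ℚ + (i + j)) ≡ a * i * b + a * (b * j)
  split = solve-∀ ℚR
  swap : ∀ a b c → a * b * c ≡ a * c * b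
  swap = solve-∀ ℚR
  null : ∀ a b → a * 0ℚ * b ≡ 0ℚ
  null = solve-∀ ℚR
  null′ : ∀ a b → a * (b * 0ℚ) ≡ 0ℚ
  null′ = solve-∀ ℚR
  left : diag (λ i j → term q i * fromℕ i * term r j) (suc n) ≡ diag h n * q
  left = begin
    term q 0 * 0ℚ * term r (suc n) + diag (λ i j → term q (suc i) * fromℕ (suc i) * term r j) n
      ≡⟨ cong₂ _+_ (null (term q 0) (term r (suc n)))
          (diag-cong n (λ i j → trans (cong (λ x → x * term r j) (term-suc q i)) (swap (term q i) q (term r j)))) ⟩
    0ℚ + diag (λ i j → h i j * q) n
      ≡⟨ +-identityˡ _ ⟩
    diag (λ i j → h i j * q) n
      ≡⟨ diag-* n h q ⟩
    diag h n * q ∎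
  right : diag (λ i j → term q i * (term r j * fromℕ j)) (suc n) ≡ diag h n * r
  right = begin
    diag (λ i j → term q i * (term r j * fromℕ j)) (suc n)
      -- The vanishing entry, `j = 0`, is here the last one of the diagonal.
      ≡⟨ diag-snoc n (λ i j → term q i * (term r j * fromℕ j)) ⟩
    diag (λ i j → term q i * (term r (suc j) * fromℕ (suc j))) n + term q (suc n) * (term r 0 * 0ℚ)
      ≡⟨ cong₂ _+_ (diag-cong n (λ i j → trans (cong (λ x → term q i * x) (term-suc r j))
                                              (sym (*-assoc (term q i) (term r j) r))))
                   (null′ (term q (suc n)) (term r 0)) ⟩
    diag (λ i j → h i j * r) n + 0ℚ
      ≡⟨ +-identityʳ _ ⟩
    diag (λ i j → h i j * r) n
      ≡⟨ diag-* n h r ⟩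
    diag h n * r ∎

-- The sum of f i * g j over i + j < n.
triangle : (ℕ → ℚ) → (ℕ → ℚ) → ℕ → ℚ
triangle f g zero    = 0ℚ
triangle f g (suc n) = f 0 * Σ< (suc n) g + triangle (f ∘ suc) g n

triangle-suc : ∀ n f g → triangle f g (suc n) ≡ triangle f g n + diag (λ i j → f i * g j) n
triangle-suc zero    f g = lemma (f 0) (g 0)
  where
  lemma : ∀ a b → a * (b + 0ℚ) + 0ℚ ≡ 0ℚ + a * b
  lemma = solve-∀ ℚR
triangle-suc (suc n) f g = trans
  (cong₂ (λ x y → f 0 * x + y) (Σ<-snoc (suc n) g) (triangle-suc n (f ∘ suc) g))
  (lemma (f 0) (Σ< (suc n) g) (g (suc n)) (triangle (f ∘ suc) g n) (diag (λ i j → f (suc i) * g j) n))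
  where
  lemma : ∀ a s b t d → a * (s + b) + (t + d) ≡ (a * s + t) + (a * b + d)
  lemma = solve-∀ ℚR

triangle-term : ∀ q r n → triangle (term q) (term r) n ≡ Σ< n (term (q + r))
triangle-term q r zero    = refl
triangle-term q r (suc n) = begin
  triangle (term q) (term r) (suc n)
    ≡⟨ triangle-suc n (term q) (term r) ⟩
  triangle (term q) (term r) n + diag (λ i j → term q i * term r j) n
    ≡⟨ cong₂ _+_ (triangle-term q r n) (diag-term q r n) ⟩
  Σ< n (term (q + r)) + term (q + r) n
    ≡⟨ sym (Σ<-snoc n (term (q + r))) ⟩
  Σ< (suc n) (term (q + r)) ∎
  where open ≡-Reasoning

-- The defect is the sum of `f i * g j` over the part of the `n` by `m` rectangle outside the
-- triangle, so it is dominated term by term. The two side lengths differ because the induction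
-- removes a row and keeps the width `m`.
triangle-defect : ∀ n m f g F G → (∀ k → ∣ f k ∣ ≤ F k) → (∀ k → ∣ g k ∣ ≤ G k) → n ℕ.≤ m →
  ∣ Σ< n f * Σ< m g - triangle f g n ∣ ≤ Σ< n F * Σ< m G - triangle F G n
triangle-defect zero    m f g F G f≤ g≤ n≤m = ≤-reflexive
  (trans (cong ∣_∣ (lemma (Σ< m g))) (sym (lemma (Σ< m G))))
  where
  lemma : ∀ a → 0ℚ * a - 0ℚ ≡ 0ℚ
  lemma = solve-∀ ℚR
triangle-defect (suc n) m f g F G f≤ g≤ n≤m = begin
  ∣ Σ< (suc n) f * Σ< m g - triangle f g (suc n) ∣
    ≡⟨ cong ∣_∣ (lemma (f 0) (Σ< n (f ∘ suc)) (Σ< m g) (Σ< (suc n) g) (triangle (f ∘ suc) g n)) ⟩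
  ∣ f 0 * (Σ< m g - Σ< (suc n) g) + (Σ< n (f ∘ suc) * Σ< m g - triangle (f ∘ suc) g n) ∣
    ≤⟨ ∣∣-mono-+ (f 0 * (Σ< m g - Σ< (suc n) g)) (Σ< n (f ∘ suc) * Σ< m g - triangle (f ∘ suc) g n)
        (∣∣-mono-* (f 0) (Σ< m g - Σ< (suc n) g) (f≤ 0) (Σ<-diff (suc n) m g G g≤ n≤m))
        (triangle-defect n m (f ∘ suc) g (F ∘ suc) G (f≤ ∘ suc) g≤ (ℕ.<⇒≤ n≤m)) ⟩
  F 0 * (Σ< m G - Σ< (suc n) G) + (Σ< n (F ∘ suc) * Σ< m G - triangle (F ∘ suc) G n)
    ≡⟨ sym (lemma (F 0) (Σ< n (F ∘ suc)) (Σ< m G) (Σ< (suc n) G) (triangle (F ∘ suc) G n)) ⟩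
  Σ< (suc n) F * Σ< m G - triangle F G (suc n) ∎
  where
  open ≤-Reasoning
  lemma : ∀ a s u v t → (a + s) * u - (a * v + t) ≡ a * (u - v) + (s * u - t)
  lemma = solve-∀ ℚR

triangle-nonneg : ∀ n f g → (∀ k → 0ℚ ≤ f k) → (∀ k → 0ℚ ≤ g k) → 0ℚ ≤ triangle f g n
triangle-nonneg zero    f g 0≤f 0≤g = ≤-refl
triangle-nonneg (suc n) f g 0≤f 0≤g = +-nonneg (f 0 * Σ< (suc n) g) (triangle (f ∘ suc) g n)
  (*-nonneg (0≤f 0) (Σ<-nonneg (suc n) g 0≤g)) (triangle-nonneg n (f ∘ suc) g (0≤f ∘ suc) 0≤g)

-- From `i < k` and `j < n` follows `i + j < k + n`, and the remaining terms of the triangle are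
-- nonnegative. The sides are independent so that rows can be removed one at a time.
square≤triangle : ∀ k n f g → (∀ k → 0ℚ ≤ f k) → (∀ k → 0ℚ ≤ g k) →
  Σ< k f * Σ< n g ≤ triangle f g (k ℕ.+ n)
square≤triangle zero    n f g 0≤f 0≤g = ≤-trans (≤-reflexive (*-zeroˡ (Σ< n g))) (triangle-nonneg n f g 0≤f 0≤g)
square≤triangle (suc k) n f g 0≤f 0≤g = begin
  (f 0 + Σ< k (f ∘ suc)) * Σ< n g
    ≡⟨ *-distribʳ-+ (Σ< n g) (f 0) (Σ< k (f ∘ suc)) ⟩
  f 0 * Σ< n g + Σ< k (f ∘ suc) * Σ< n g
    ≤⟨ +-mono-≤
        (*-monoˡ-≤-nonNeg (f 0) {{nonNegative (0≤f 0)}} (Σ<-extend g 0≤g (ℕ.m≤n⇒m≤1+n (ℕ.m≤n+m n k))))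
        (square≤triangle k n (f ∘ suc) g (0≤f ∘ suc) 0≤g) ⟩
  f 0 * Σ< (suc (k ℕ.+ n)) g + triangle (f ∘ suc) g (k ℕ.+ n) ∎
  where open ≤-Reasoning

-- The square of side n lies in the triangle of side n + n.
exp-defect : ∀ q r b n → 0ℚ < b → ∣ q ∣ ≤ b → ∣ r ∣ ≤ b →
  let S = λ x k → Σ< k (term x) in
  ∣ S q (n ℕ.+ n) * S r (n ℕ.+ n) - S (q + r) (n ℕ.+ n) ∣ ≤ S b (n ℕ.+ n) * S b (n ℕ.+ n) - S b n * S b n
exp-defect q r b n 0<b q≤b r≤b = begin
  ∣ Σ< N (term q) * Σ< N (term r) - Σ< N (term (q + r)) ∣
    ≡⟨ cong (λ x → ∣ Σ< N (term q) * Σ< N (term r) - x ∣) (sym (triangle-term q r N)) ⟩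
  ∣ Σ< N (term q) * Σ< N (term r) - triangle (term q) (term r) N ∣
    ≤⟨ triangle-defect N N (term q) (term r) (term b) (term b)
        (λ k → ∣term∣≤ q b k q≤b) (λ k → ∣term∣≤ r b k r≤b) ℕ.≤-refl ⟩
  Σ< N (term b) * Σ< N (term b) - triangle (term b) (term b) N
    ≤⟨ +-monoʳ-≤ (Σ< N (term b) * Σ< N (term b)) (neg-antimono-≤
        (square≤triangle n n (term b) (term b) term-nonneg term-nonneg)) ⟩
  Σ< N (term b) * Σ< N (term b) - Σ< n (term b) * Σ< n (term b) ∎
  where
  open ≤-Reasoning
  open ExpSeries b 0<b using (term-nonneg)
  N = n ℕ.+ n

-- Order on the reals

-- The bound `δ ≤ 1ℚ` lets `*-close` absorb a product of two errors into a single one.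
shrink : ∀ C {ε} → 0ℚ < C → 0ℚ < ε → ∃ λ δ → 0ℚ < δ × δ ≤ 1ℚ × δ * C ≤ ε
shrink C {ε} 0<C 0<ε = δ , 0<δ , p⊓q≤q η 1ℚ , (begin
  δ * C            ≤⟨ *-monoʳ-≤-nonNeg C {{pos⇒nonNeg C}} (p⊓q≤p η 1ℚ) ⟩
  ε * 1/ C * C     ≡⟨ *-assoc ε (1/ C) C ⟩
  ε * (1/ C * C)   ≡⟨ cong (λ q → ε * q) (*-inverseˡ C) ⟩
  ε * 1ℚ           ≡⟨ *-identityʳ ε ⟩
  ε                ∎)
  where
  open ≤-Reasoning
  instance
    C-pos : Positive C
    C-pos = positive 0<C
    C-nonZero : NonZero C
    C-nonZero = pos⇒nonZero C
  η = ε * 1/ C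
  δ = η ⊓ 1ℚ
  0<δ : 0ℚ < δ
  0<δ with ⊓-sel η 1ℚ
  ... | inj₁ eq = subst (0ℚ <_) (sym eq) (*-pos 0<ε (positive⁻¹ (1/ C) {{1/pos⇒pos C}}))
  ... | inj₂ eq = subst (0ℚ <_) (sym eq) (fromℕ-pos 0)

infix 4 _≼_

-- _≤ℝ_ as a record, since the definition unfolds and then hides its
-- arguments from unification.
record _≼_ (x y : ℝ) : Set where
  constructor wrap
  field unwrap : x ≤ℝ y

open _≼_

pointwise : ∀ {x y} → (∀ l → seq x l ≤ seq y l) → x ≼ y
pointwise {x} {y} h = wrap λ ε 0<ε → 0 , λ n _ → ≤-trans (h n)
  (≤-trans (≤-reflexive (sym (+-identityʳ (seq y n)))) (+-monoʳ-≤ (seq y n) (<⇒≤ 0<ε)))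

-- Sums and products of reals are formed term by term, so an algebraic identity becomes a ring
-- identity in `ℚ` at each index. Limits such as `exp` are not formed this way and need estimates.
pointwise-≡ : ∀ {x y} → (∀ l → seq x l ≡ seq y l) → x ≼ y
pointwise-≡ h = pointwise (≤-reflexive ∘ h)

≼-refl : ∀ {x} → x ≼ x
≼-refl = pointwise-≡ (λ _ → refl)

≼-trans : ∀ {x y z} → x ≼ y → y ≼ z → x ≼ z
≼-trans {x} {y} {z} (wrap x≤y) (wrap y≤z) = wrap λ ε 0<ε →
  let M , hx = x≤y (half ε) (half-pos 0<ε)
      N , hy = y≤z (half ε) (half-pos 0<ε)
  in M ℕ.⊔ N , λ n le → begin
    seq x n                         ≤⟨ hx n (ℕ.m⊔n≤o⇒m≤o M N le) ⟩
    seq y n + half ε                ≤⟨ +-monoˡ-≤ (half ε) (hy n (ℕ.m⊔n≤o⇒n≤o M N le)) ⟩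
    seq z n + half ε + half ε       ≡⟨ +-assoc (seq z n) (half ε) (half ε) ⟩
    seq z n + (half ε + half ε)     ≡⟨ cong (λ q → seq z n + q) (half+half ε) ⟩
    seq z n + ε                     ∎
  where open ≤-Reasoning

module ≼-Reasoning where
  open import Relation.Binary.Reasoning.Base.Single _≼_ ≼-refl ≼-trans public
    using (begin_; step-∼; _∎)

≼-approx : ∀ {x y} → (∀ ε → 0ℚ < ε → x ≼ y +ℝ fromℚ ε) → x ≼ y
≼-approx {x} {y} h = wrap λ ε 0<ε →
  let N , le = unwrap (h (half ε) (half-pos 0<ε)) (half ε) (half-pos 0<ε)
  in N , λ n N≤n → ≤-trans (le n N≤n) (≤-reflexive
    (trans (+-assoc (seq y n) (half ε) (half ε)) (cong (λ q → seq y n + q) (half+half ε))))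

+-mono-≼ : ∀ {x x′ y y′} → x ≼ x′ → y ≼ y′ → x +ℝ y ≼ x′ +ℝ y′
+-mono-≼ {x} {x′} {y} {y′} (wrap hx) (wrap hy) = wrap λ ε 0<ε →
  let M , h = hx (half ε) (half-pos 0<ε)
      N , k = hy (half ε) (half-pos 0<ε)
  in M ℕ.⊔ N , λ n le →
    ≤-trans (+-mono-≤ (h n (ℕ.m⊔n≤o⇒m≤o M N le)) (k n (ℕ.m⊔n≤o⇒n≤o M N le)))
      (≤-reflexive (trans (lemma (seq x′ n) (seq y′ n) (half ε)) (cong (λ q → seq x′ n + seq y′ n + q) (half+half ε))))
  where
  lemma : ∀ a b h → (a + h) + (b + h) ≡ a + b + (h + h)
  lemma = solve-∀ ℚR

neg-antimono-≼ : ∀ {x y} → x ≼ y → -ℝ y ≼ -ℝ x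
neg-antimono-≼ {x} {y} x≼y = begin
  -ℝ y                       ∼⟨ pointwise-≡ (λ l → lemma (seq x l) (seq y l)) ⟩
  x +ℝ (-ℝ x +ℝ -ℝ y)        ∼⟨ +-mono-≼ x≼y (≼-refl { -ℝ x +ℝ -ℝ y}) ⟩
  y +ℝ (-ℝ x +ℝ -ℝ y)        ∼⟨ pointwise-≡ (λ l → lemma′ (seq x l) (seq y l)) ⟩
  -ℝ x                       ∎
  where
  open ≼-Reasoning
  lemma : ∀ a b → - b ≡ a + (- a + - b)
  lemma = solve-∀ ℚR
  lemma′ : ∀ a b → b + (- a + - b) ≡ - a
  lemma′ = solve-∀ ℚR

x≼x+ε : ∀ {x ε} → 0ℚ < ε → x ≼ x +ℝ fromℚ ε
x≼x+ε {x} {ε} 0<ε = pointwise λ l →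
  ≤-trans (≤-reflexive (sym (+-identityʳ (seq x l)))) (+-monoʳ-≤ (seq x l) (<⇒≤ 0<ε))

+-nonneg-≼ : ∀ {x y} → 0ℝ ≼ x → 0ℝ ≼ y → 0ℝ ≼ x +ℝ y
+-nonneg-≼ 0≼x 0≼y = ≼-trans (pointwise-≡ (λ _ → refl)) (+-mono-≼ 0≼x 0≼y)

-- The terms of a nonnegative real may still dip below zero by any small `δ`. A negative factor is
-- then at most `δ` in size, the other factor is bounded, and `δ` is chosen against the sum of both
-- bounds.
*-nonneg-≼ : ∀ {x y} → 0ℝ ≼ x → 0ℝ ≼ y → 0ℝ ≼ x *ℝ y
*-nonneg-≼ {x} {y} (wrap 0≤x) (wrap 0≤y) = wrap λ ε 0<ε →
  let A , 0<A , K , hA = bounded (seq x) (cauchy x)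
      B , 0<B , L , hB = bounded (seq y) (cauchy y)
      δ , 0<δ , _ , small = shrink (A + B) (+-mono-<-≤ 0<A (<⇒≤ 0<B)) 0<ε
      M , hx = 0≤x δ 0<δ
      N , hy = 0≤y δ 0<δ
  in (K ℕ.⊔ L) ℕ.⊔ (M ℕ.⊔ N) , λ n le →
    let KL≤n = ℕ.m⊔n≤o⇒m≤o (K ℕ.⊔ L) (M ℕ.⊔ N) le
        MN≤n = ℕ.m⊔n≤o⇒n≤o (K ℕ.⊔ L) (M ℕ.⊔ N) le
        δA≤ε = ≤-trans (*-monoˡ-≤-nonNeg δ {{nonNegative (<⇒≤ 0<δ)}}
                 (≤-trans (≤-reflexive (sym (+-identityʳ A))) (+-monoʳ-≤ A (<⇒≤ 0<B)))) small
        δB≤ε = ≤-trans (*-monoˡ-≤-nonNeg δ {{nonNegative (<⇒≤ 0<δ)}}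
                 (≤-trans (≤-reflexive (sym (+-identityˡ B))) (+-monoˡ-≤ B (<⇒≤ 0<A)))) small
    in go (seq x n) (seq y n) (<⇒≤ 0<δ) (<⇒≤ 0<ε) δA≤ε δB≤ε
          (hA n (ℕ.m⊔n≤o⇒m≤o K L KL≤n)) (hB n (ℕ.m⊔n≤o⇒n≤o K L KL≤n))
          (hx n (ℕ.m⊔n≤o⇒m≤o M N MN≤n)) (hy n (ℕ.m⊔n≤o⇒n≤o M N MN≤n))
  where
  tiny : ∀ p {δ} → p ≤ 0ℚ → 0ℚ ≤ δ → 0ℚ ≤ p + δ → ∣ p ∣ ≤ δ
  tiny p {δ} p≤0 0≤δ 0≤p+δ = subst (λ q → ∣ q ∣ ≤ δ) (+-identityʳ p)
    (≤⇒dist p 0ℚ (≤-trans p≤0 (+-nonneg 0ℚ δ ≤-refl 0≤δ)) 0≤p+δ)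
  above : ∀ p {ε} → ∣ p ∣ ≤ ε → 0ℚ ≤ p + ε
  above p {ε} h = dist⇒≤ 0ℚ p (subst (_≤ ε)
    (trans (cong ∣_∣ (sym (+-identityʳ p))) (∣p-q∣≡∣q-p∣ p 0ℚ)) h)
  go : ∀ p q {A B δ ε} → 0ℚ ≤ δ → 0ℚ ≤ ε → δ * A ≤ ε → δ * B ≤ ε → ∣ p ∣ ≤ A → ∣ q ∣ ≤ B →
       0ℚ ≤ p + δ → 0ℚ ≤ q + δ → 0ℚ ≤ p * q + ε
  go p q {A} {B} {δ} {ε} 0≤δ 0≤ε δA δB p≤A q≤B 0≤p 0≤q with ≤-total 0ℚ p | ≤-total 0ℚ q
  ... | inj₁ 0≤p′ | inj₁ 0≤q′ = +-nonneg (p * q) ε (*-nonneg 0≤p′ 0≤q′) 0≤ε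
  ... | inj₂ p≤0 | _ = above (p * q) (≤-trans (∣∣-mono-* p q (tiny p p≤0 0≤δ 0≤p) q≤B) δB)
  ... | inj₁ _ | inj₂ q≤0 = above (p * q) (≤-trans (∣∣-mono-* p q p≤A (tiny q q≤0 0≤δ 0≤q))
          (≤-trans (≤-reflexive (*-comm A δ)) δA))

*-monoˡ-≼ : ∀ z {x y} → 0ℝ ≼ z → x ≼ y → z *ℝ x ≼ z *ℝ y
*-monoˡ-≼ z {x} {y} 0≼z x≼y = begin
  z *ℝ x                         ∼⟨ pointwise-≡ (λ l → sym (+-identityʳ (seq z l * seq x l))) ⟩
  z *ℝ x +ℝ 0ℝ                   ∼⟨ +-mono-≼ (≼-refl {z *ℝ x}) (*-nonneg-≼ 0≼z 0≼y-x) ⟩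
  z *ℝ x +ℝ z *ℝ (y +ℝ -ℝ x)     ∼⟨ pointwise-≡ (λ l → lemma (seq z l) (seq x l) (seq y l)) ⟩
  z *ℝ y                         ∎
  where
  open ≼-Reasoning
  lemma : ∀ z x y → z * x + z * (y + - x) ≡ z * y
  lemma = solve-∀ ℚR
  0≼y-x : 0ℝ ≼ y +ℝ -ℝ x
  0≼y-x = begin
    0ℝ           ∼⟨ pointwise-≡ (λ l → sym (+-inverseʳ (seq x l))) ⟩
    x +ℝ -ℝ x    ∼⟨ +-mono-≼ x≼y (≼-refl { -ℝ x}) ⟩
    y +ℝ -ℝ x    ∎

*-monoʳ-≼ : ∀ z {x y} → 0ℝ ≼ z → x ≼ y → x *ℝ z ≼ y *ℝ z
*-monoʳ-≼ z {x} {y} 0≼z x≼y = begin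
  x *ℝ z    ∼⟨ pointwise-≡ (λ l → *-comm (seq x l) (seq z l)) ⟩
  z *ℝ x    ∼⟨ *-monoˡ-≼ z 0≼z x≼y ⟩
  z *ℝ y    ∼⟨ pointwise-≡ (λ l → *-comm (seq z l) (seq y l)) ⟩
  y *ℝ z    ∎
  where open ≼-Reasoning

*-mono-≼ : ∀ {x x′ y y′} → 0ℝ ≼ x′ → 0ℝ ≼ y → x ≼ x′ → y ≼ y′ → x *ℝ y ≼ x′ *ℝ y′
*-mono-≼ {x} {x′} {y} {y′} 0≼x′ 0≼y x≼x′ y≼y′ = ≼-trans (*-monoʳ-≼ y 0≼y x≼x′) (*-monoˡ-≼ x′ 0≼x′ y≼y′)

*-≼1 : ∀ {x y} → 0ℝ ≼ y → x ≼ 1ℝ → x *ℝ y ≼ y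
*-≼1 {x} {y} 0≼y x≼1 = ≼-trans (*-monoʳ-≼ y 0≼y x≼1) (pointwise-≡ (λ l → *-identityˡ (seq y l)))

sum-mono-≼ : ∀ {n} {f g : Fin n → ℝ} → (∀ i → f i ≼ g i) → sum f ≼ sum g
sum-mono-≼ {zero}  h = ≼-refl
sum-mono-≼ {suc n} h = +-mono-≼ (h zero) (sum-mono-≼ (h ∘ suc))

sum-nonneg-≼ : ∀ {n} {f : Fin n → ℝ} → (∀ i → 0ℝ ≼ f i) → 0ℝ ≼ sum f
sum-nonneg-≼ {zero}  h = ≼-refl
sum-nonneg-≼ {suc n} h = +-nonneg-≼ (h zero) (sum-nonneg-≼ (h ∘ suc))

product-nonneg-≼ : ∀ {n} {f : Fin n → ℝ} → (∀ i → 0ℝ ≼ f i) → 0ℝ ≼ product f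
product-nonneg-≼ {zero}  h = pointwise (λ _ → fromℕ-nonneg 1)
product-nonneg-≼ {suc n} h = *-nonneg-≼ (h zero) (product-nonneg-≼ (h ∘ suc))

≼-from-index : ∀ x y {ε} K → 0ℚ < ε →
  (∀ l → K ℕ.≤ l → ∣ seq x l - seq x K ∣ ≤ half ε) →
  (∀ l → K ℕ.≤ l → ∣ seq y l - seq y K ∣ ≤ half ε) →
  seq x K ≤ seq y K → x ≼ y +ℝ fromℚ ε
≼-from-index x y {ε} K 0<ε hx hy le = wrap λ α 0<α → K , λ l K≤l → begin
  seq x l                           ≤⟨ dist⇒≤ (seq x l) (seq x K) (hx l K≤l) ⟩
  seq x K + half ε                  ≤⟨ +-monoˡ-≤ (half ε) le ⟩
  seq y K + half ε                  ≤⟨ +-monoˡ-≤ (half ε) (dist⇒≤ (seq y K) (seq y l)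
                                         (subst (_≤ half ε) (∣p-q∣≡∣q-p∣ (seq y l) (seq y K)) (hy l K≤l))) ⟩
  seq y l + half ε + half ε         ≡⟨ +-assoc (seq y l) (half ε) (half ε) ⟩
  seq y l + (half ε + half ε)       ≡⟨ cong (λ q → seq y l + q) (half+half ε) ⟩
  seq y l + ε                       ≡⟨ sym (+-identityʳ (seq y l + ε)) ⟩
  seq y l + ε + 0ℚ                  ≤⟨ +-monoʳ-≤ (seq y l + ε) (<⇒≤ 0<α) ⟩
  seq y l + ε + α                   ∎
  where open ≤-Reasoning

-- A substitute for totality of the order: comparing one pair of rational terms, at an index where
-- both sequences have settled to within `half ε`, decides the order up to `ε`.
≼-total-approx : ∀ x y {ε} → 0ℚ < ε → x ≼ y +ℝ fromℚ ε ⊎ y ≼ x +ℝ fromℚ ε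
≼-total-approx x y {ε} 0<ε =
  let M , hx = cauchy x (half ε) (half-pos 0<ε)
      N , hy = cauchy y (half ε) (half-pos 0<ε)
      K = M ℕ.⊔ N
      nearX = λ l le → hx l K (ℕ.m⊔n≤o⇒m≤o M N le) (ℕ.m≤m⊔n M N)
      nearY = λ l le → hy l K (ℕ.m⊔n≤o⇒n≤o M N le) (ℕ.m≤n⊔m M N)
  in Sum.map (≼-from-index x y K 0<ε nearX nearY) (≼-from-index y x K 0<ε nearY nearX)
       (≤-total (seq x K) (seq y K))

-- Functional equation of exp, and Poisson moments

Eventually : (ℕ → Set) → Set
Eventually P = ∃ λ L → ∀ l → L ℕ.≤ l → P l

eventually-× : ∀ {P Q : ℕ → Set} → Eventually P → Eventually Q → Eventually (λ l → P l × Q l)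
eventually-× (K , p) (L , q) = K ℕ.⊔ L , λ l le → p l (ℕ.m⊔n≤o⇒m≤o K L le) , q l (ℕ.m⊔n≤o⇒n≤o K L le)

eventually-map : ∀ {P Q : ℕ → Set} → (∀ l → P l → Q l) → Eventually P → Eventually Q
eventually-map f (K , p) = K , λ l le → f l (p l le)

-- Two-sided and stated on the terms, so that errors of products can be estimated with rational
-- absolute values before returning to `_≼_`.
Close : ℚ → ℝ → ℝ → Set
Close ε x y = Eventually (λ l → ∣ seq x l - seq y l ∣ ≤ ε)

close⇒≼ : ∀ x y {ε} → Close ε x y → x ≼ y +ℝ fromℚ ε
close⇒≼ x y {ε} (L , h) = wrap λ α 0<α → L , λ l le →
  ≤-trans (dist⇒≤ (seq x l) (seq y l) (h l le))
    (≤-trans (≤-reflexive (sym (+-identityʳ (seq y l + ε)))) (+-monoʳ-≤ (seq y l + ε) (<⇒≤ 0<α)))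

close-sym : ∀ x y {ε} → Close ε x y → Close ε y x
close-sym x y {ε} = eventually-map λ l → subst (_≤ ε) (∣p-q∣≡∣q-p∣ (seq x l) (seq y l))

exp-limit : ∀ x {η} → 0ℚ < η → Eventually (λ n → Close η (expPartial x n) (exp x))
exp-limit x {η} 0<η = eventually-map close (lim-converges (expPartial x) (expPartial-cauchy x) (half η) (half-pos 0<η))
  where
  merge : ∀ p {q} → q ≤ p + half η + half η → q ≤ p + η
  merge p le = ≤-trans le (≤-reflexive
    (trans (+-assoc p (half η) (half η)) (cong (λ q → p + q) (half+half η))))
  close : ∀ n → expPartial x n ≤ℝ exp x +ℝ fromℚ (half η) × exp x ≤ℝ expPartial x n +ℝ fromℚ (half η) →
          Close η (expPartial x n) (exp x)
  close n (below , above) =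
    eventually-map (λ l (b , a) → ≤⇒dist (seq (expPartial x n) l) (seq (exp x) l)
        (merge (seq (exp x) l) b) (merge (seq (expPartial x n) l) a))
      (eventually-× (below (half η) (half-pos 0<η)) (above (half η) (half-pos 0<η)))

seq-expPartial : ∀ x n l → seq (expPartial x n) l ≡ Σ< n (term (seq x l))
seq-expPartial x n l = trans (seq-sum {n} _ l) (sum-cong {n} (λ k → seq-expTerm x (toℕ k) l))

*-close : ∀ p q p′ q′ A B {δ} → δ ≤ 1ℚ → ∣ p - p′ ∣ ≤ δ → ∣ q - q′ ∣ ≤ δ → ∣ p′ ∣ ≤ A → ∣ q′ ∣ ≤ B →
  ∣ p * q - p′ * q′ ∣ ≤ δ * (1ℚ + (A + B))
*-close p q p′ q′ A B {δ} δ≤1 dp dq p≤ q≤ = begin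
  ∣ p * q - p′ * q′ ∣
    ≡⟨ cong ∣_∣ (split p q p′ q′) ⟩
  ∣ (p - p′) * (q - q′) + (p′ * (q - q′) + (p - p′) * q′) ∣
    ≤⟨ ∣∣-mono-+ ((p - p′) * (q - q′)) (p′ * (q - q′) + (p - p′) * q′)
        (∣∣-mono-* (p - p′) (q - q′) dp (≤-trans dq δ≤1))
        (∣∣-mono-+ (p′ * (q - q′)) ((p - p′) * q′) (∣∣-mono-* p′ (q - q′) p≤ dq) (∣∣-mono-* (p - p′) q′ dp q≤)) ⟩
  δ * 1ℚ + (A * δ + δ * B)
    ≡⟨ collect δ 1ℚ A B ⟩
  δ * (1ℚ + (A + B)) ∎
  where
  open ≤-Reasoning
  split : ∀ p q p′ q′ → p * q - p′ * q′ ≡ (p - p′) * (q - q′) + (p′ * (q - q′) + (p - p′) * q′)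
  split = solve-∀ ℚR
  collect : ∀ d u a b → d * u + (a * d + d * b) ≡ d * (u + (a + b))
  collect = solve-∀ ℚR

-- Passes from `exp x *ℝ exp y` to the product of the partial sums, then to the partial sum at `z`,
-- then to `exp z`. Taking any `z` with the right terms, instead of `x +ℝ y`, avoids showing that
-- `exp` respects equality of reals.
exp-+-close : ∀ x y z → (∀ l → seq z l ≡ seq x l + seq y l) → ∀ ε → 0ℚ < ε → Close ε (exp x *ℝ exp y) (exp z)
exp-+-close x y z z≡x+y ε 0<ε =
  let A , 0<A , boundA = bounded (seq (exp x)) (cauchy (exp x))
      B , 0<B , boundB = bounded (seq (exp y)) (cauchy (exp y))
      C , 0<C , boundC = bounded (seq x) (cauchy x)
      D , 0<D , boundD = bounded (seq y) (cauchy y)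
      δ , 0<δ , δ≤1 , small = shrink (1ℚ + (A + B))
        (+-mono-<-≤ (fromℕ-pos 0) (+-nonneg A B (<⇒≤ 0<A) (<⇒≤ 0<B))) 0<τ
      b = C ⊔ D
      0<b = <-≤-trans 0<C (p≤p⊔q C D)
      S = λ n → Σ< n (term b)
      S-cauchy = ExpSeries.partial-cauchy b 0<b
      N , tail = *-cauchy S S S-cauchy S-cauchy τ 0<τ
      K , partials = eventually-× (exp-limit x 0<δ) (eventually-× (exp-limit y 0<δ) (exp-limit z 0<τ))
      M = K ℕ.⊔ N
      -- A doubled length, so that `exp-defect` bounds the middle error by `S n * S n - S M * S M`,
      -- which `tail` makes small.
      n = M ℕ.+ M
      N≤M = ℕ.m≤n⊔m K N
      M≤n = ℕ.m≤m+n M M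
      close-x , close-y , close-z = partials n (ℕ.≤-trans (ℕ.m≤m⊔n K N) M≤n)
      defect = ≤-trans (p≤∣p∣ (S n * S n - S M * S M)) (tail n M (ℕ.≤-trans N≤M M≤n) N≤M)
  in eventually-map (λ l (dx , dy , dz , eA , eB , xC , yD) →
       combine (seq (expPartial x n) l) (seq (expPartial y n) l) (seq (expPartial z n) l)
         (seq (exp x) l) (seq (exp y) l) (seq (exp z) l)
         (≤-trans (*-close (seq (expPartial x n) l) (seq (expPartial y n) l) (seq (exp x) l) (seq (exp y) l)
                    A B δ≤1 dx dy eA eB) small)
         (subst₂ (λ p q → ∣ p - q ∣ ≤ τ)
           (sym (cong₂ _*_ (seq-expPartial x n l) (seq-expPartial y n l)))
           (sym (trans (seq-expPartial z n l) (cong (λ q → Σ< n (term q)) (z≡x+y l))))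
           (≤-trans (exp-defect (seq x l) (seq y l) b M 0<b
             (≤-trans xC (p≤p⊔q C D)) (≤-trans yD (p≤q⊔p C D))) defect))
         dz)
     (eventually-× close-x (eventually-× close-y (eventually-× close-z
       (eventually-× boundA (eventually-× boundB (eventually-× boundC boundD))))))
  where
  -- Three errors are added: from replacing both factors by partial sums, from the defect, and from
  -- the limit at `z`. A quarter of `ε` for each is enough.
  τ = half (half ε)
  0<τ = half-pos (half-pos 0<ε)
  combine : ∀ p q r p′ q′ r′ → ∣ p * q - p′ * q′ ∣ ≤ τ → ∣ p * q - r ∣ ≤ τ → ∣ r - r′ ∣ ≤ τ →
            ∣ p′ * q′ - r′ ∣ ≤ ε
  combine p q r p′ q′ r′ d₁ d₂ d₃ = begin
    ∣ p′ * q′ - r′ ∣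
      ≡⟨ cong ∣_∣ (telescope (p * q) r (p′ * q′) r′) ⟩
    ∣ (p′ * q′ - p * q) + ((p * q - r) + (r - r′)) ∣
      ≤⟨ ∣∣-mono-+ (p′ * q′ - p * q) ((p * q - r) + (r - r′))
          (subst (_≤ τ) (∣p-q∣≡∣q-p∣ (p * q) (p′ * q′)) d₁)
          (∣∣-mono-+ (p * q - r) (r - r′) d₂ d₃) ⟩
    τ + (τ + τ)
      ≤⟨ +-monoˡ-≤ (τ + τ) (≤-trans (≤-reflexive (sym (+-identityʳ τ))) (+-monoʳ-≤ τ (<⇒≤ 0<τ))) ⟩
    (τ + τ) + (τ + τ)
      ≡⟨ cong (λ q → q + q) (half+half (half ε)) ⟩
    half ε + half ε
      ≡⟨ half+half ε ⟩
    ε ∎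
    where
    open ≤-Reasoning
    telescope : ∀ u r v s → v - s ≡ (v - u) + ((u - r) + (r - s))
    telescope = solve-∀ ℚR

exp-+-≼ : ∀ x y z → (∀ l → seq z l ≡ seq x l + seq y l) → exp z ≼ exp x *ℝ exp y
exp-+-≼ x y z eq = ≼-approx λ ε 0<ε →
  close⇒≼ (exp z) (exp x *ℝ exp y) (close-sym (exp x *ℝ exp y) (exp z) (exp-+-close x y z eq ε 0<ε))

exp-*-≼ : ∀ x y z → (∀ l → seq z l ≡ seq x l + seq y l) → exp x *ℝ exp y ≼ exp z
exp-*-≼ x y z eq = ≼-approx λ ε 0<ε → close⇒≼ (exp x *ℝ exp y) (exp z) (exp-+-close x y z eq ε 0<ε)

square-nonneg : ∀ x → 0ℝ ≼ x *ℝ x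
square-nonneg x = pointwise λ l → go (seq x l)
  where
  neg² : ∀ p → - p * - p ≡ p * p
  neg² = solve-∀ ℚR
  go : ∀ p → 0ℚ ≤ p * p
  go p with ≤-total 0ℚ p
  ... | inj₁ 0≤p = *-nonneg 0≤p 0≤p
  ... | inj₂ p≤0 = subst (0ℚ ≤_) (neg² p) (*-nonneg (neg-antimono-≤ p≤0) (neg-antimono-≤ p≤0))

-- For negative `x` the series alternates and shows no sign, but `exp x` is the square of `exp` at
-- half of `x`.
exp-nonneg : ∀ x → 0ℝ ≼ exp x
exp-nonneg x = ≼-trans (square-nonneg (exp x/2)) (exp-*-≼ x/2 x/2 x λ l →
  trans (sym (half+half (seq x l))) (cong₂ _+_ (*-comm ½ (seq x l)) (*-comm ½ (seq x l))))
  where x/2 = x *ℝ fromℚ ½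

exp-zero-≼ : ∀ z → (∀ l → seq z l ≡ 0ℚ) → exp z ≼ 1ℝ
exp-zero-≼ z z≡0 = ≼-approx λ ε 0<ε →
  let K , h = exp-limit z 0<ε in
  -- The length `suc K` guarantees that the constant term is present; the empty partial sum would be
  -- 0.
  ≼-trans (close⇒≼ (exp z) (expPartial z (suc K)) (close-sym (expPartial z (suc K)) (exp z) (h (suc K) (ℕ.n≤1+n K))))
    (+-mono-≼ {expPartial z (suc K)} {1ℝ} (pointwise-≡ (λ l → trans (seq-expPartial z (suc K) l)
        (trans (cong (λ q → Σ< (suc K) (term q)) (z≡0 l)) (partial-zero K))))
      (≼-refl {fromℚ ε}))
  where
  partial-zero : ∀ k → Σ< (suc k) (term 0ℚ) ≡ 1ℚ
  partial-zero k = trans (cong (λ q → term 0ℚ 0 + q) (sum-zero {k} λ j →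
      trans (cong (_* 1/! suc (toℕ j)) (*-zeroˡ (0ℚ ℚS.^ toℕ j))) (*-zeroˡ (1/! suc (toℕ j))))) refl

sum-extend-≼ : ∀ {m n} (f : ℕ → ℝ) → (∀ k → 0ℝ ≼ f k) → m ℕ.≤ n → sum {m} (f ∘ toℕ) ≼ sum {n} (f ∘ toℕ)
sum-extend-≼ {n = zero}  f 0≼f ℕ.z≤n = ≼-refl
sum-extend-≼ {n = suc n} f 0≼f ℕ.z≤n = +-nonneg-≼ (0≼f 0) (sum-extend-≼ {n = n} (f ∘ suc) (0≼f ∘ suc) ℕ.z≤n)
sum-extend-≼ f 0≼f (ℕ.s≤s le) = +-mono-≼ (≼-refl {f 0}) (sum-extend-≼ (f ∘ suc) (0≼f ∘ suc) le)

^-nonneg-≼ : ∀ {x} k → 0ℝ ≼ x → 0ℝ ≼ x ^ k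
^-nonneg-≼ zero    0≼x = pointwise (λ _ → fromℕ-nonneg 1)
^-nonneg-≼ (suc k) 0≼x = *-nonneg-≼ 0≼x (^-nonneg-≼ k 0≼x)

expTerm-nonneg : ∀ {x} → 0ℝ ≼ x → ∀ k → 0ℝ ≼ expTerm x k
expTerm-nonneg 0≼x k = *-nonneg-≼ (^-nonneg-≼ k 0≼x) (pointwise {0ℝ} {fromℚ (1/! k)} (λ _ → 1/!-nonneg k))

expPartial-≼ : ∀ {x} n → 0ℝ ≼ x → expPartial x n ≼ exp x
expPartial-≼ {x} n 0≼x = ≼-approx λ ε 0<ε →
  let K , h = exp-limit x 0<ε in
  ≼-trans (sum-extend-≼ (expTerm x) (expTerm-nonneg 0≼x) (ℕ.m≤m⊔n n K)) (close⇒≼ (expPartial x (n ℕ.⊔ K)) (exp x) (h (n ℕ.⊔ K) (ℕ.m≤n⊔m n K)))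

poisson-nonneg : ∀ {μ} → 0ℝ ≼ μ → ∀ k → 0ℝ ≼ poisson μ k
poisson-nonneg {μ} 0≼μ k = *-nonneg-≼ (exp-nonneg (-ℝ μ)) (expTerm-nonneg 0≼μ k)

Σ<-*ˡ : ∀ n f c → Σ< n (λ k → c * f k) ≡ c * Σ< n f
Σ<-*ˡ n f c = sym (*-distribˡ-sum {n} c (f ∘ toℕ))

-- For `μ ≥ 0` the partial sums stay below `exp μ`, which the functional equation cancels against
-- `exp (-ℝ μ)`.
poisson-mass : ∀ {μ} n → 0ℝ ≼ μ → sum {n} (poisson μ ∘ toℕ) ≼ 1ℝ
poisson-mass {μ} n 0≼μ = begin
  sum {n} (poisson μ ∘ toℕ)       ∼⟨ pointwise-≡ (λ l → trans (seq-sum {n} (poisson μ ∘ toℕ) l)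
                                       (trans (Σ<-*ˡ n (λ k → seq (expTerm μ k) l) (seq (exp (-ℝ μ)) l))
                                              (cong (λ q → seq (exp (-ℝ μ)) l * q) (sym (seq-sum {n} (expTerm μ ∘ toℕ) l))))) ⟩
  exp (-ℝ μ) *ℝ expPartial μ n    ∼⟨ *-monoˡ-≼ (exp (-ℝ μ)) (exp-nonneg (-ℝ μ)) (expPartial-≼ n 0≼μ) ⟩
  exp (-ℝ μ) *ℝ exp μ             ∼⟨ exp-*-≼ (-ℝ μ) μ 0ℝ (λ l → sym (+-inverseˡ (seq μ l))) ⟩
  exp 0ℝ                          ∼⟨ exp-zero-≼ 0ℝ (λ _ → refl) ⟩
  1ℝ                              ∎
  where open ≼-Reasoning

-- Since `k + 1` times the probability of `k + 1` is `μ` times the probability of `k`, and the term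
-- at 0 vanishes, the mean cut off at `suc n` is `μ` times the mass cut off at `n`.
poisson-mean : ∀ {μ} n → 0ℝ ≼ μ → sum {suc n} (λ k → poisson μ (toℕ k) *ℝ fromℚ (fromℕ (toℕ k))) ≼ μ
poisson-mean {μ} n 0≼μ = begin
  sum {suc n} weighted            ∼⟨ pointwise-≡ shifted ⟩
  μ *ℝ sum {n} (poisson μ ∘ toℕ)  ∼⟨ *-monoˡ-≼ μ 0≼μ (poisson-mass n 0≼μ) ⟩
  μ *ℝ 1ℝ                         ∼⟨ pointwise-≡ (λ l → *-identityʳ (seq μ l)) ⟩
  μ                               ∎
  where
  open ≼-Reasoning
  weighted : ∀ {n} → Fin n → ℝ
  weighted k = poisson μ (toℕ k) *ℝ fromℚ (fromℕ (toℕ k))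
  shift : ∀ l k → seq (poisson μ (suc k)) l * fromℕ (suc k) ≡ seq μ l * seq (poisson μ k) l
  shift l k = begin′
    e * seq (expTerm μ (suc k)) l * fromℕ (suc k)    ≡⟨ cong (λ q → e * q * fromℕ (suc k)) (seq-expTerm μ (suc k) l) ⟩
    e * term (seq μ l) (suc k) * fromℕ (suc k)       ≡⟨ *-assoc e (term (seq μ l) (suc k)) (fromℕ (suc k)) ⟩
    e * (term (seq μ l) (suc k) * fromℕ (suc k))     ≡⟨ cong (λ q → e * q) (term-suc (seq μ l) k) ⟩
    e * (term (seq μ l) k * seq μ l)                 ≡⟨ regroup e (term (seq μ l) k) (seq μ l) ⟩
    seq μ l * (e * term (seq μ l) k)                 ≡⟨ cong (λ q → seq μ l * (e * q)) (sym (seq-expTerm μ k l)) ⟩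
    seq μ l * (e * seq (expTerm μ k) l)              ∎′
    where
    open ≡-Reasoning using (step-≡-⟩) renaming (begin_ to begin′_; _∎ to _∎′)
    e = seq (exp (-ℝ μ)) l
    regroup : ∀ e t m → e * (t * m) ≡ m * (e * t)
    regroup = solve-∀ ℚR
  shifted : ∀ l → seq (sum {suc n} weighted) l ≡ seq (μ *ℝ sum {n} (poisson μ ∘ toℕ)) l
  shifted l = trans (seq-sum {suc n} weighted l)
    (trans (cong₂ _+_ (*-zeroʳ (seq (poisson μ 0) l)) (sum-cong {n} (λ k → shift l (toℕ k))))
      (trans (+-identityˡ _)
        (trans (Σ<-*ˡ n (λ k → seq (poisson μ k) l) (seq μ l))
          (cong (λ q → seq μ l * q) (sym (seq-sum {n} (poisson μ ∘ toℕ) l))))))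

poisson-0 : ∀ μ l → seq (poisson μ 0) l ≡ seq (exp (-ℝ μ)) l
poisson-0 μ l = *-identityʳ (seq (exp (-ℝ μ)) l)

-- Truncated expectations

boxSumℚ-cong : ∀ N {m} {g h : Vec ℕ m → ℚ} → (∀ c → g c ≡ h c) → boxSumℚ N g ≡ boxSumℚ N h
boxSumℚ-cong N {zero}  eq = eq []
boxSumℚ-cong N {suc m} eq = sum-cong {N} (λ k → boxSumℚ-cong N (λ c → eq (toℕ k ∷ c)))

boxSumℚ-* : ∀ N {m} a (g : Vec ℕ m → ℚ) → boxSumℚ N (λ c → a * g c) ≡ a * boxSumℚ N g
boxSumℚ-* N {zero}  a g = refl
boxSumℚ-* N {suc m} a g = trans (sum-cong {N} (λ k → boxSumℚ-* N a (λ c → g (toℕ k ∷ c))))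
  (sym (*-distribˡ-sum {N} a (λ k → boxSumℚ N (λ c → g (toℕ k ∷ c)))))

boxSumℚ-+ : ∀ N {m} (g h : Vec ℕ m → ℚ) → boxSumℚ N (λ c → g c + h c) ≡ boxSumℚ N g + boxSumℚ N h
boxSumℚ-+ N {zero}  g h = refl
boxSumℚ-+ N {suc m} g h = trans
  (sum-cong {N} (λ k → boxSumℚ-+ N (λ c → g (toℕ k ∷ c)) (λ c → h (toℕ k ∷ c))))
  (∑-distrib-+ {N} (λ k → boxSumℚ N (λ c → g (toℕ k ∷ c))) (λ k → boxSumℚ N (λ c → h (toℕ k ∷ c))))

boxSumℚ-sum : ∀ N {m n} (g : Fin n → Vec ℕ m → ℚ) →
  boxSumℚ N (λ c → ℚS.sum (λ i → g i c)) ≡ ℚS.sum (λ i → boxSumℚ N (g i))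
boxSumℚ-sum N {zero}  g = refl
boxSumℚ-sum N {suc m} {n} g = trans
  (sum-cong {N} (λ k → boxSumℚ-sum N (λ i c → g i (toℕ k ∷ c))))
  (∑-comm {N} {n} (λ k i → boxSumℚ N (λ c → g i (toℕ k ∷ c))))

boxSumℚ-split : ∀ n N {m} {g : ℕ → Vec ℕ m → ℚ} (u : ℕ → ℚ) v → (∀ k c → g k c ≡ u k * v c) →
  Σ< n (λ k → boxSumℚ N (g k)) ≡ Σ< n u * boxSumℚ N v
boxSumℚ-split n N u v eq = trans
  (sum-cong {n} (λ k → trans (boxSumℚ-cong N (eq (toℕ k))) (boxSumℚ-* N (u (toℕ k)) v)))
  (Σ<-* n u (boxSumℚ N v))

boxSum-mono-≼ : ∀ N {m} {g h : Vec ℕ m → ℝ} → (∀ c → g c ≼ h c) → boxSum N g ≼ boxSum N h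
boxSum-mono-≼ N {zero}  le = le []
boxSum-mono-≼ N {suc m} le = sum-mono-≼ {N} (λ k → boxSum-mono-≼ N (λ c → le (toℕ k ∷ c)))

boxSum-nonneg-≼ : ∀ N {m} {g : Vec ℕ m → ℝ} → (∀ c → 0ℝ ≼ g c) → 0ℝ ≼ boxSum N g
boxSum-nonneg-≼ N {zero}  le = le []
boxSum-nonneg-≼ N {suc m} le = sum-nonneg-≼ {N} (λ k → boxSum-nonneg-≼ N (λ c → le (toℕ k ∷ c)))

-- Independence of the first type from the others: a summand that factors gives a product of two
-- sums. The range `n` is separate from the side `N` because `anyArrives-probability` sums the first
-- count over positive values only.
boxSum-split : ∀ n N {m} (g : ℕ → Vec ℕ m → ℝ) (u : ℕ → ℝ) (v : Vec ℕ m → ℝ) →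
  (∀ l k c → seq (g k c) l ≡ seq (u k) l * seq (v c) l) →
  sum {n} (λ k → boxSum N (g (toℕ k))) ≼ sum {n} (u ∘ toℕ) *ℝ boxSum N v
boxSum-split n N g u v eq = pointwise-≡ λ l → begin
  seq (sum {n} (λ k → boxSum N (g (toℕ k)))) l
    ≡⟨ seq-sum {n} (λ k → boxSum N (g (toℕ k))) l ⟩
  Σ< n (λ k → seq (boxSum N (g k)) l)
    ≡⟨ sum-cong {n} (λ k → seq-boxSum N (g (toℕ k)) l) ⟩
  Σ< n (λ k → boxSumℚ N (λ c → seq (g k c) l))
    ≡⟨ boxSumℚ-split n N (λ k → seq (u k) l) (λ c → seq (v c) l) (eq l) ⟩
  Σ< n (λ k → seq (u k) l) * boxSumℚ N (λ c → seq (v c) l)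
    ≡⟨ sym (cong₂ _*_ (seq-sum {n} (u ∘ toℕ) l) (seq-boxSum N v l)) ⟩
  seq (sum {n} (u ∘ toℕ)) l * seq (boxSum N v) l ∎
  where open ≡-Reasoning

likelihood-nonneg : ∀ {m} (rate : Fin m → ℝ) → (∀ i → 0ℝ ≼ rate i) → ∀ c → 0ℝ ≼ likelihood rate c
likelihood-nonneg rate 0≼rate c = product-nonneg-≼ (λ i → poisson-nonneg (0≼rate i) (Vec.lookup c i))

likelihood-mass : ∀ N {m} (rate : Fin m → ℝ) → (∀ i → 0ℝ ≼ rate i) → boxSum N (likelihood rate) ≼ 1ℝ
likelihood-mass N {zero}  rate 0≼rate = ≼-refl
likelihood-mass N {suc m} rate 0≼rate = begin
  boxSum N (likelihood rate)
    ∼⟨ boxSum-split N N (λ k c → likelihood rate (k ∷ c)) (poisson (rate zero)) (likelihood (rate ∘ suc)) (λ _ _ _ → refl) ⟩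
  sum {N} (poisson (rate zero) ∘ toℕ) *ℝ boxSum N (likelihood (rate ∘ suc))
    ∼⟨ *-≼1 (boxSum-nonneg-≼ N (likelihood-nonneg (rate ∘ suc) (0≼rate ∘ suc))) (poisson-mass N (0≼rate zero)) ⟩
  boxSum N (likelihood (rate ∘ suc))
    ∼⟨ likelihood-mass N (rate ∘ suc) (0≼rate ∘ suc) ⟩
  1ℝ ∎
  where open ≼-Reasoning

partialExpectation-mono : ∀ N {m} (rate : Fin m → ℝ) → (∀ i → 0ℝ ≼ rate i) → ∀ {f g} → (∀ c → f c ≼ g c) →
  partialExpectation rate f N ≼ partialExpectation rate g N
partialExpectation-mono N rate 0≼rate f≼g =
  boxSum-mono-≼ N (λ c → *-monoˡ-≼ (likelihood rate c) (likelihood-nonneg rate 0≼rate c) (f≼g c))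

partialExpectation-nonneg : ∀ N {m} (rate : Fin m → ℝ) → (∀ i → 0ℝ ≼ rate i) → ∀ {f} → (∀ c → 0ℝ ≼ f c) →
  0ℝ ≼ partialExpectation rate f N
partialExpectation-nonneg N rate 0≼rate 0≼f =
  boxSum-nonneg-≼ N (λ c → *-nonneg-≼ (likelihood-nonneg rate 0≼rate c) (0≼f c))

count : ∀ {m} → Fin m → Vec ℕ m → ℝ
count i c = fromℚ (fromℕ (Vec.lookup c i))

-- The other types factor out with mass at most one, which leaves `poisson-mean` for type `i`. The
-- side `suc N` is the form in which that lemma splits off the count 0.
expected-count : ∀ N {m} (rate : Fin m → ℝ) → (∀ i → 0ℝ ≼ rate i) → ∀ i →
  partialExpectation rate (count i) (suc N) ≼ rate i
expected-count N {suc m} rate 0≼rate zero = begin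
  partialExpectation rate (count zero) (suc N)
    ∼⟨ boxSum-split (suc N) (suc N) (λ k c → likelihood rate (k ∷ c) *ℝ fromℚ (fromℕ k))
        (λ k → poisson (rate zero) k *ℝ fromℚ (fromℕ k)) (likelihood (rate ∘ suc))
        (λ l k c → lemma (seq (poisson (rate zero) k) l) (seq (likelihood (rate ∘ suc) c) l) (fromℕ k)) ⟩
  sum {suc N} (λ k → poisson (rate zero) (toℕ k) *ℝ fromℚ (fromℕ (toℕ k))) *ℝ boxSum (suc N) (likelihood (rate ∘ suc))
    ∼⟨ *-mono-≼ (0≼rate zero) (boxSum-nonneg-≼ (suc N) (likelihood-nonneg (rate ∘ suc) (0≼rate ∘ suc)))
        (poisson-mean N (0≼rate zero)) (likelihood-mass (suc N) (rate ∘ suc) (0≼rate ∘ suc)) ⟩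
  rate zero *ℝ 1ℝ
    ∼⟨ pointwise-≡ (λ l → *-identityʳ (seq (rate zero) l)) ⟩
  rate zero ∎
  where
  open ≼-Reasoning
  lemma : ∀ a b c → a * b * c ≡ a * c * b
  lemma = solve-∀ ℚR
expected-count N {suc m} rate 0≼rate (suc i) = begin
  partialExpectation rate (count (suc i)) (suc N)
    ∼⟨ boxSum-split (suc N) (suc N) (λ k c → likelihood rate (k ∷ c) *ℝ count i c)
        (poisson (rate zero)) (λ c → likelihood (rate ∘ suc) c *ℝ count i c)
        (λ l k c → *-assoc (seq (poisson (rate zero) k) l) (seq (likelihood (rate ∘ suc) c) l) (fromℕ (Vec.lookup c i))) ⟩
  sum {suc N} (poisson (rate zero) ∘ toℕ) *ℝ partialExpectation (rate ∘ suc) (count i) (suc N)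
    ∼⟨ *-≼1 (partialExpectation-nonneg (suc N) (rate ∘ suc) (0≼rate ∘ suc)
             (λ c → pointwise {0ℝ} {count i c} (λ _ → fromℕ-nonneg (Vec.lookup c i))))
           (poisson-mass (suc N) (0≼rate zero)) ⟩
  partialExpectation (rate ∘ suc) (count i) (suc N)
    ∼⟨ expected-count N (rate ∘ suc) (0≼rate ∘ suc) i ⟩
  rate (suc i) ∎
  where open ≼-Reasoning

-- Recursive in the order in which `boxSum` nests its sums, so that the probability can be computed
-- one type at a time.
anyArrives : ∀ {m} → Subset m → Vec ℕ m → ℚ
anyArrives []          []          = 0ℚ
anyArrives (false ∷ S) (k ∷ c)     = anyArrives S c
anyArrives (true ∷ S)  (zero ∷ c)  = anyArrives S c
anyArrives (true ∷ S)  (suc k ∷ c) = 1ℚ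

anyArrives-nonneg : ∀ {m} (S : Subset m) c → 0ℚ ≤ anyArrives S c
anyArrives-nonneg []          []          = ≤-refl
anyArrives-nonneg (false ∷ S) (k ∷ c)     = anyArrives-nonneg S c
anyArrives-nonneg (true ∷ S)  (zero ∷ c)  = anyArrives-nonneg S c
anyArrives-nonneg (true ∷ S)  (suc k ∷ c) = fromℕ-nonneg 1

-- If the first type is in `S`, split by whether its count is 0, with probability `p₀`, or positive,
-- with truncated probability `Q`. The total is at most `p₀ * (1 - exp z′) + Q`, that is
-- `(p₀ + Q) - p₀ * exp z′`; here `p₀ + Q` is a mass, at most 1, and `p₀ * exp z′` is at least
-- `exp z` by the functional equation. The real `z` is fixed only through its terms, as types
-- outside `S` put a `0ℝ` in front of `sumOver`.
anyArrives-probability : ∀ N {m} (rate : Fin m → ℝ) → (∀ i → 0ℝ ≼ rate i) → ∀ S z →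
  (∀ l → seq z l ≡ - seq (sumOver S rate) l) →
  partialExpectation rate (fromℚ ∘ anyArrives S) (suc N) ≼ 1ℝ +ℝ -ℝ exp z
anyArrives-probability N {zero} rate 0≼rate [] z eq = begin
  1ℝ *ℝ 0ℝ         ∼⟨ pointwise-≡ (λ _ → refl) ⟩
  1ℝ +ℝ -ℝ 1ℝ      ∼⟨ +-mono-≼ (≼-refl {1ℝ}) (neg-antimono-≼ (exp-zero-≼ z eq)) ⟩
  1ℝ +ℝ -ℝ exp z   ∎
  where open ≼-Reasoning
anyArrives-probability N {suc m} rate 0≼rate (false ∷ S) z eq = begin
  partialExpectation rate (fromℚ ∘ anyArrives (false ∷ S)) (suc N)
    ∼⟨ boxSum-split (suc N) (suc N) (λ k c → likelihood rate (k ∷ c) *ℝ fromℚ (anyArrives S c))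
        (poisson (rate zero)) (λ c → likelihood (rate ∘ suc) c *ℝ fromℚ (anyArrives S c))
        (λ l k c → *-assoc (seq (poisson (rate zero) k) l) (seq (likelihood (rate ∘ suc) c) l) (anyArrives S c)) ⟩
  sum {suc N} (poisson (rate zero) ∘ toℕ) *ℝ partialExpectation (rate ∘ suc) (fromℚ ∘ anyArrives S) (suc N)
    ∼⟨ *-≼1 (partialExpectation-nonneg (suc N) (rate ∘ suc) (0≼rate ∘ suc)
             (λ c → pointwise {0ℝ} {fromℚ (anyArrives S c)} (λ _ → anyArrives-nonneg S c)))
           (poisson-mass (suc N) (0≼rate zero)) ⟩
  partialExpectation (rate ∘ suc) (fromℚ ∘ anyArrives S) (suc N)
    ∼⟨ anyArrives-probability N (rate ∘ suc) (0≼rate ∘ suc) S z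
        (λ l → trans (eq l) (cong -_ (+-identityˡ (seq (sumOver S (rate ∘ suc)) l)))) ⟩
  1ℝ +ℝ -ℝ exp z ∎
  where open ≼-Reasoning
anyArrives-probability N {suc m} rate 0≼rate (true ∷ S) z eq = begin
  partialExpectation rate (fromℚ ∘ anyArrives (true ∷ S)) (suc N)
    ∼⟨ +-mono-≼ {boxSum (suc N) (λ c → g (0 ∷ c))} missed arrived ⟩
  p₀ *ℝ partialExpectation (rate ∘ suc) (fromℚ ∘ anyArrives S) (suc N) +ℝ Q *ℝ boxSum (suc N) (likelihood (rate ∘ suc))
    ∼⟨ +-mono-≼
        (*-monoˡ-≼ p₀ (poisson-nonneg (0≼rate zero) 0)
          (anyArrives-probability N (rate ∘ suc) (0≼rate ∘ suc) S z′ (λ _ → refl)))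
        (*-monoˡ-≼ Q (sum-nonneg-≼ {N} (λ k → poisson-nonneg (0≼rate zero) (suc (toℕ k))))
          (likelihood-mass (suc N) (rate ∘ suc) (0≼rate ∘ suc))) ⟩
  p₀ *ℝ (1ℝ +ℝ -ℝ exp z′) +ℝ Q *ℝ 1ℝ
    ∼⟨ pointwise-≡ (λ l → trans (collect (seq p₀ l) (seq Q l) (seq (exp z′) l))
                               (cong (λ q → seq p₀ l + seq Q l - q * seq (exp z′) l) (poisson-0 (rate zero) l))) ⟩
  (p₀ +ℝ Q) +ℝ -ℝ (exp (-ℝ rate zero) *ℝ exp z′)
    ∼⟨ +-mono-≼ (poisson-mass (suc N) (0≼rate zero)) (neg-antimono-≼ (exp-+-≼ (-ℝ rate zero) z′ z
        (λ l → trans (eq l) (neg-distrib-+ (seq (rate zero) l) (seq (sumOver S (rate ∘ suc)) l))))) ⟩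
  1ℝ +ℝ -ℝ exp z ∎
  where
  open ≼-Reasoning
  p₀ = poisson (rate zero) 0
  Q = sum {N} (poisson (rate zero) ∘ suc ∘ toℕ)
  z′ = -ℝ sumOver S (rate ∘ suc)
  g : Vec ℕ (suc m) → ℝ
  g c = likelihood rate c *ℝ fromℚ (anyArrives (true ∷ S) c)
  collect : ∀ p q e → p * (1ℚ + - e) + q * 1ℚ ≡ p + q - p * e
  collect = solve-∀ ℚR
  swap : ∀ a b → a * b * 1ℚ ≡ a * b
  swap = solve-∀ ℚR
  missed : boxSum (suc N) (λ c → g (0 ∷ c)) ≼ p₀ *ℝ partialExpectation (rate ∘ suc) (fromℚ ∘ anyArrives S) (suc N)
  missed = pointwise-≡ λ l → trans (seq-boxSum (suc N) (λ c → g (0 ∷ c)) l)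
    (trans (boxSumℚ-cong (suc N) (λ c → *-assoc (seq p₀ l) (seq (likelihood (rate ∘ suc) c) l) (anyArrives S c)))
      (trans (boxSumℚ-* (suc N) (seq p₀ l) (λ c → seq (likelihood (rate ∘ suc) c) l * anyArrives S c))
        (cong (λ q → seq p₀ l * q) (sym (seq-boxSum (suc N) (λ c → likelihood (rate ∘ suc) c *ℝ fromℚ (anyArrives S c)) l)))))
  arrived : sum {N} (λ k → boxSum (suc N) (λ c → g (suc (toℕ k) ∷ c))) ≼ Q *ℝ boxSum (suc N) (likelihood (rate ∘ suc))
  arrived = boxSum-split N (suc N) (λ k c → g (suc k ∷ c)) (poisson (rate zero) ∘ suc) (likelihood (rate ∘ suc))
    (λ l k c → swap (seq (poisson (rate zero) (suc k)) l) (seq (likelihood (rate ∘ suc) c) l))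

-- Linearity of truncated expectations

seq-partialExpectation : ∀ N {m} (rate : Fin m → ℝ) f l →
  seq (partialExpectation rate f N) l ≡ boxSumℚ N (λ c → seq (likelihood rate c) l * seq (f c) l)
seq-partialExpectation N rate f l = seq-boxSum N (λ c → likelihood rate c *ℝ f c) l

seq-sum-cong : ∀ {n} (f g : Fin n → ℝ) l → (∀ i → seq (f i) l ≡ seq (g i) l) → seq (sum f) l ≡ seq (sum g) l
seq-sum-cong f g l eq = trans (seq-sum f l) (trans (sum-cong eq) (sym (seq-sum g l)))

partialExpectation-cong : ∀ N {m} (rate : Fin m → ℝ) f g l → (∀ c → seq (f c) l ≡ seq (g c) l) →
  seq (partialExpectation rate f N) l ≡ seq (partialExpectation rate g N) l
partialExpectation-cong N rate f g l eq = trans (seq-partialExpectation N rate f l)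
  (trans (boxSumℚ-cong N (λ c → cong (λ q → seq (likelihood rate c) l * q) (eq c)))
    (sym (seq-partialExpectation N rate g l)))

partialExpectation-sum : ∀ N {m n} (rate : Fin m → ℝ) (f : Fin n → Vec ℕ m → ℝ) l →
  seq (sum (λ j → partialExpectation rate (f j) N)) l ≡ seq (partialExpectation rate (λ c → sum (λ j → f j c)) N) l
partialExpectation-sum N rate f l = begin
  seq (sum (λ j → partialExpectation rate (f j) N)) l
    ≡⟨ seq-sum (λ j → partialExpectation rate (f j) N) l ⟩
  ℚS.sum (λ j → seq (partialExpectation rate (f j) N) l)
    ≡⟨ sum-cong (λ j → seq-partialExpectation N rate (f j) l) ⟩
  ℚS.sum (λ j → boxSumℚ N (λ c → seq (likelihood rate c) l * seq (f j c) l))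
    ≡⟨ sym (boxSumℚ-sum N (λ j c → seq (likelihood rate c) l * seq (f j c) l)) ⟩
  boxSumℚ N (λ c → ℚS.sum (λ j → seq (likelihood rate c) l * seq (f j c) l))
    ≡⟨ boxSumℚ-cong N (λ c → trans (sym (*-distribˡ-sum (seq (likelihood rate c) l) (λ j → seq (f j c) l)))
         (cong (λ q → seq (likelihood rate c) l * q) (sym (seq-sum (λ j → f j c) l)))) ⟩
  boxSumℚ N (λ c → seq (likelihood rate c) l * seq (sum (λ j → f j c)) l)
    ≡⟨ sym (seq-partialExpectation N rate (λ c → sum (λ j → f j c)) l) ⟩
  seq (partialExpectation rate (λ c → sum (λ j → f j c)) N) l ∎
  where open ≡-Reasoning

partialExpectation-* : ∀ N {m} (rate : Fin m → ℝ) a f l →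
  seq (a *ℝ partialExpectation rate f N) l ≡ seq (partialExpectation rate (λ c → a *ℝ f c) N) l
partialExpectation-* N rate a f l = begin
  seq a l * seq (partialExpectation rate f N) l
    ≡⟨ cong (λ q → seq a l * q) (seq-partialExpectation N rate f l) ⟩
  seq a l * boxSumℚ N (λ c → seq (likelihood rate c) l * seq (f c) l)
    ≡⟨ sym (boxSumℚ-* N (seq a l) (λ c → seq (likelihood rate c) l * seq (f c) l)) ⟩
  boxSumℚ N (λ c → seq a l * (seq (likelihood rate c) l * seq (f c) l))
    ≡⟨ boxSumℚ-cong N (λ c → lemma (seq a l) (seq (likelihood rate c) l) (seq (f c) l)) ⟩
  boxSumℚ N (λ c → seq (likelihood rate c) l * (seq a l * seq (f c) l))
    ≡⟨ sym (seq-partialExpectation N rate (λ c → a *ℝ f c) l) ⟩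
  seq (partialExpectation rate (λ c → a *ℝ f c) N) l ∎
  where
  open ≡-Reasoning
  lemma : ∀ a p q → a * (p * q) ≡ p * (a * q)
  lemma = solve-∀ ℚR

partialExpectation-if : ∀ N {m} (rate : Fin m → ℝ) (b : Bool) f l →
  seq (if b then partialExpectation rate f N else 0ℝ) l ≡
  seq (partialExpectation rate (λ c → if b then f c else 0ℝ) N) l
partialExpectation-if N rate true  f l = refl
partialExpectation-if N rate false f l = begin
  0ℚ                                                        ≡⟨ sym (*-zeroˡ (seq (partialExpectation rate f N) l)) ⟩
  0ℚ * seq (partialExpectation rate f N) l                  ≡⟨ partialExpectation-* N rate 0ℝ f l ⟩
  seq (partialExpectation rate (λ c → 0ℝ *ℝ f c) N) l       ≡⟨ partialExpectation-cong N rate (λ c → 0ℝ *ℝ f c) (λ _ → 0ℝ) l (λ c → *-zeroˡ (seq (f c) l)) ⟩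
  seq (partialExpectation rate (λ c → 0ℝ) N) l              ∎
  where open ≡-Reasoning

-- An error of `ε` at every arrival vector costs at most `ε` on average, because the box has mass at
-- most one.
partialExpectation-shift : ∀ N {m} (rate : Fin m → ℝ) → (∀ i → 0ℝ ≼ rate i) → ∀ f {ε} → 0ℚ ≤ ε →
  partialExpectation rate (λ c → f c +ℝ fromℚ ε) N ≼ partialExpectation rate f N +ℝ fromℚ ε
partialExpectation-shift N rate 0≼rate f {ε} 0≤ε = begin
  partialExpectation rate (λ c → f c +ℝ fromℚ ε) N
    ∼⟨ pointwise-≡ split ⟩
  partialExpectation rate f N +ℝ fromℚ ε *ℝ boxSum N (likelihood rate)
    ∼⟨ +-mono-≼ (≼-refl {partialExpectation rate f N})
        (*-monoˡ-≼ (fromℚ ε) (pointwise {0ℝ} {fromℚ ε} (λ _ → 0≤ε)) (likelihood-mass N rate 0≼rate)) ⟩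
  partialExpectation rate f N +ℝ fromℚ ε *ℝ 1ℝ
    ∼⟨ pointwise-≡ (λ l → cong (λ q → seq (partialExpectation rate f N) l + q) (*-identityʳ ε)) ⟩
  partialExpectation rate f N +ℝ fromℚ ε ∎
  where
  open ≼-Reasoning
  lemma : ∀ p f e → p * (f + e) ≡ p * f + e * p
  lemma = solve-∀ ℚR
  split : ∀ l → seq (partialExpectation rate (λ c → f c +ℝ fromℚ ε) N) l ≡
                seq (partialExpectation rate f N +ℝ fromℚ ε *ℝ boxSum N (likelihood rate)) l
  split l = trans (seq-partialExpectation N rate (λ c → f c +ℝ fromℚ ε) l)
    (trans (boxSumℚ-cong N (λ c → lemma (seq (likelihood rate c) l) (seq (f c) l) ε))
      (trans (boxSumℚ-+ N (λ c → seq (likelihood rate c) l * seq (f c) l) (λ c → ε * seq (likelihood rate c) l))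
        (cong₂ _+_ (sym (seq-partialExpectation N rate f l))
          (trans (boxSumℚ-* N ε (λ c → seq (likelihood rate c) l))
            (cong (λ q → ε * q) (sym (seq-boxSum N (likelihood rate) l)))))))

-- Matchings as feasible points

-- The Kronecker delta, recursive instead of via decidable equality, so that sums against it
-- simplify by computation.
δ : ∀ {n} → Fin n → Fin n → ℚ
δ zero    zero    = 1ℚ
δ zero    (suc j) = 0ℚ
δ (suc i) zero    = 0ℚ
δ (suc i) (suc j) = δ i j

δ-refl : ∀ {n} (i : Fin n) → δ i i ≡ 1ℚ
δ-refl zero    = refl
δ-refl (suc i) = δ-refl i

δ-sym : ∀ {n} (i j : Fin n) → δ i j ≡ δ j i
δ-sym zero    zero    = refl
δ-sym zero    (suc j) = refl
δ-sym (suc i) zero    = refl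
δ-sym (suc i) (suc j) = δ-sym i j

δ-≢ : ∀ {n} (i j : Fin n) → i ≢ j → δ i j ≡ 0ℚ
δ-≢ zero    zero    i≢j = contradiction refl i≢j
δ-≢ zero    (suc j) i≢j = refl
δ-≢ (suc i) zero    i≢j = refl
δ-≢ (suc i) (suc j) i≢j = δ-≢ i j (i≢j ∘ cong suc)

δ-nonneg : ∀ {n} (i j : Fin n) → 0ℚ ≤ δ i j
δ-nonneg zero    zero    = fromℕ-nonneg 1
δ-nonneg zero    (suc j) = ≤-refl
δ-nonneg (suc i) zero    = ≤-refl
δ-nonneg (suc i) (suc j) = δ-nonneg i j

sum-δ : ∀ {n} (f : Fin n → ℚ) k → ℚS.sum (λ i → f i * δ k i) ≡ f k
sum-δ f zero    = trans (cong₂ _+_ (*-identityʳ (f zero)) (sum-zero (λ i → *-zeroʳ (f (suc i))))) (+-identityʳ (f zero))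
sum-δ f (suc k) = trans (cong₂ _+_ (*-zeroʳ (f zero)) (sum-δ (f ∘ suc) k)) (+-identityˡ (f (suc k)))

indicator : ∀ {n} → Maybe (Fin n) → Fin n → ℚ
indicator q i = maybe (λ k → δ k i) 0ℚ q

indicator-nonneg : ∀ {n} (q : Maybe (Fin n)) i → 0ℚ ≤ indicator q i
indicator-nonneg nothing  i = ≤-refl
indicator-nonneg (just k) i = δ-nonneg k i

sum-indicator : ∀ {n} (f : Fin n → ℚ) q → ℚS.sum (λ i → f i * indicator q i) ≡ maybe f 0ℚ q
sum-indicator f nothing  = sum-zero (λ i → *-zeroʳ (f i))
sum-indicator f (just k) = sum-δ f k

member≤anyArrives : ∀ {m} (S : Subset m) c k → 1ℚ ≤ fromℕ (Vec.lookup c k) → (if Vec.lookup S k then 1ℚ else 0ℚ) ≤ anyArrives S c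
member≤anyArrives (false ∷ S) (x ∷ c)     zero    1≤ = anyArrives-nonneg S c
member≤anyArrives (true ∷ S)  (zero ∷ c)  zero    (*≤* (ℤ.+≤+ ()))
member≤anyArrives (true ∷ S)  (suc x ∷ c) zero    1≤ = ≤-refl
member≤anyArrives (false ∷ S) (x ∷ c)     (suc k) 1≤ = member≤anyArrives S c k 1≤
member≤anyArrives (true ∷ S)  (zero ∷ c)  (suc k) 1≤ = member≤anyArrives S c k 1≤
member≤anyArrives (true ∷ S)  (suc x ∷ c) (suc k) 1≤ with Vec.lookup S k
... | true  = ≤-refl
... | false = fromℕ-nonneg 1

-- The sum has at most one nonzero summand, at the type in `q`; it counts only if that type lies in
-- `S`, and then the hypothesis says that the type arrives.
sumOver≤anyArrives : ∀ {m} (S : Subset m) c q → (∀ k → q ≡ just k → 1ℚ ≤ fromℕ (Vec.lookup c k)) →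
  ℚS.sum (λ i → if Vec.lookup S i then indicator q i else 0ℚ) ≤ anyArrives S c
sumOver≤anyArrives S c q 1≤ = ≤-trans
  (≤-reflexive (trans (sum-cong (λ i → scale (Vec.lookup S i) (indicator q i)))
                      (sum-indicator (λ i → if Vec.lookup S i then 1ℚ else 0ℚ) q)))
  (bound q 1≤)
  where
  scale : ∀ b p → (if b then p else 0ℚ) ≡ (if b then 1ℚ else 0ℚ) * p
  scale true  p = sym (*-identityˡ p)
  scale false p = sym (*-zeroˡ p)
  bound : ∀ q → (∀ k → q ≡ just k → 1ℚ ≤ fromℕ (Vec.lookup c k)) →
          maybe (λ i → if Vec.lookup S i then 1ℚ else 0ℚ) 0ℚ q ≤ anyArrives S c
  bound nothing  1≤ = anyArrives-nonneg S c
  bound (just k) 1≤ = member≤anyArrives S c k (1≤ k refl)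

-- partner c j is the type of the online vertex matched to j, if any.
module Assignment {m n} (rate : Fin m → ℝ) (0≼rate : ∀ i → 0ℝ ≼ rate i)
                  (partner : Vec ℕ m → Fin n → Maybe (Fin m))
                  (used≤count : ∀ c i → ℚS.sum (λ j → indicator (partner c j) i) ≤ fromℕ (Vec.lookup c i))
                  (N : ℕ) where
  open ≼-Reasoning

  used : Fin m → Fin n → Vec ℕ m → ℝ
  used i j c = fromℚ (indicator (partner c j) i)

  flow : Fin m → Fin n → ℝ
  flow i j = partialExpectation rate (used i j) (suc N)

  capacity : ∀ i → sum (flow i) ≼ rate i
  capacity i = begin
    sum (flow i)
      ∼⟨ pointwise-≡ (partialExpectation-sum (suc N) rate (used i)) ⟩
    partialExpectation rate (λ c → sum (λ j → used i j c)) (suc N)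
      ∼⟨ partialExpectation-mono (suc N) rate 0≼rate (λ c → pointwise {sum (λ j → used i j c)} {count i c} (λ l →
           ≤-trans (≤-reflexive (seq-sum (λ j → used i j c) l)) (used≤count c i))) ⟩
    partialExpectation rate (count i) (suc N)
      ∼⟨ expected-count N rate 0≼rate i ⟩
    rate i ∎

  arrival : ∀ j S → sumOver S (λ i → flow i j) ≼ 1ℝ +ℝ -ℝ exp (-ℝ sumOver S rate)
  arrival j S = begin
    sumOver S (λ i → flow i j)
      ∼⟨ pointwise-≡ (λ l → trans
           (seq-sum-cong (λ i → if Vec.lookup S i then flow i j else 0ℝ)
             (λ i → partialExpectation rate (λ c → if Vec.lookup S i then used i j c else 0ℝ) (suc N)) l
             (λ i → partialExpectation-if (suc N) rate (Vec.lookup S i) (used i j) l))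
           (partialExpectation-sum (suc N) rate (λ i c → if Vec.lookup S i then used i j c else 0ℝ) l)) ⟩
    partialExpectation rate (λ c → sumOver S (λ i → used i j c)) (suc N)
      ∼⟨ partialExpectation-mono (suc N) rate 0≼rate (λ c →
           pointwise {sumOver S (λ i → used i j c)} {fromℚ (anyArrives S c)} (λ l →
             ≤-trans (≤-reflexive (trans (seq-sum (λ i → if Vec.lookup S i then used i j c else 0ℝ) l)
                        (sum-cong (λ i → seq-if (Vec.lookup S i) (indicator (partner c j) i) l))))
               (sumOver≤anyArrives S c (partner c j) (present c)))) ⟩
    partialExpectation rate (fromℚ ∘ anyArrives S) (suc N)
      ∼⟨ anyArrives-probability N rate 0≼rate S (-ℝ sumOver S rate) (λ _ → refl) ⟩
    1ℝ +ℝ -ℝ exp (-ℝ sumOver S rate) ∎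
    where
    seq-if : ∀ b p l → seq (if b then fromℚ p else 0ℝ) l ≡ (if b then p else 0ℚ)
    seq-if true  p l = refl
    seq-if false p l = refl
    -- The bound `used≤count` serves a second time here: if `j` is served by type `k`, at least one
    -- vertex of type `k` is used, so at least one has arrived.
    present : ∀ c k → partner c j ≡ just k → 1ℚ ≤ fromℕ (Vec.lookup c k)
    present c k eq = ≤-trans
      (≤-reflexive (sym (trans (cong (λ q → indicator q k) eq) (δ-refl k))))
      (≤-trans (summand≤sum (λ j → indicator-nonneg (partner c j) k) j) (used≤count c k))

  feasible : Feasible rate flow
  feasible = record
    { capacity = λ i → unwrap (capacity i)
    ; arrival  = λ j S → unwrap (arrival j S)
    ; nonneg   = λ i j → unwrap (partialExpectation-nonneg (suc N) rate 0≼rate (λ c →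
                   pointwise {0ℝ} {used i j c} (λ _ → indicator-nonneg (partner c j) i)))
    }

  -- Linearity of expectation and an interchange of the sums over `i` and `j`: for fixed `c` and `j`
  -- the sum over `i` collapses to the weight of the partner.
  objective-flow : ∀ (w : Fin m → Fin n → ℝ) →
    partialExpectation rate (λ c → sum (λ j → maybe (λ k → w k j) 0ℝ (partner c j))) (suc N) ≼ objective w flow
  objective-flow w = pointwise-≡ λ l → sym (begin′
    seq (objective w flow) l
      ≡⟨ seq-sum-cong (λ i → sum (λ j → w i j *ℝ flow i j))
           (λ i → partialExpectation rate (λ c → sum (λ j → w i j *ℝ used i j c)) (suc N)) l (λ i → trans
           (seq-sum-cong (λ j → w i j *ℝ flow i j)
             (λ j → partialExpectation rate (λ c → w i j *ℝ used i j c) (suc N)) l (λ j → partialExpectation-* (suc N) rate (w i j) (used i j) l))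
           (partialExpectation-sum (suc N) rate (λ j c → w i j *ℝ used i j c) l)) ⟩
    seq (sum (λ i → partialExpectation rate (λ c → sum (λ j → w i j *ℝ used i j c)) (suc N))) l
      ≡⟨ partialExpectation-sum (suc N) rate (λ i c → sum (λ j → w i j *ℝ used i j c)) l ⟩
    seq (partialExpectation rate (λ c → sum (λ i → sum (λ j → w i j *ℝ used i j c))) (suc N)) l
      ≡⟨ partialExpectation-cong (suc N) rate (λ c → sum (λ i → sum (λ j → w i j *ℝ used i j c)))
           (λ c → sum (λ j → maybe (λ k → w k j) 0ℝ (partner c j))) l (λ c → regroup c l) ⟩
    seq (partialExpectation rate (λ c → sum (λ j → maybe (λ k → w k j) 0ℝ (partner c j))) (suc N)) l ∎′)
    where
    open ≡-Reasoning using (step-≡-⟩) renaming (begin_ to begin′_; _∎ to _∎′)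
    seq-maybe : ∀ (f : Fin m → ℝ) q l → maybe (λ k → seq (f k) l) 0ℚ q ≡ seq (maybe f 0ℝ q) l
    seq-maybe f nothing  l = refl
    seq-maybe f (just k) l = refl
    regroup : ∀ c l → seq (sum (λ i → sum (λ j → w i j *ℝ used i j c))) l ≡
                      seq (sum (λ j → maybe (λ k → w k j) 0ℝ (partner c j))) l
    regroup c l = begin′
      seq (sum (λ i → sum (λ j → w i j *ℝ used i j c))) l
        ≡⟨ trans (seq-sum (λ i → sum (λ j → w i j *ℝ used i j c)) l) (sum-cong (λ i → seq-sum (λ j → w i j *ℝ used i j c) l)) ⟩
      ℚS.sum (λ i → ℚS.sum (λ j → seq (w i j) l * indicator (partner c j) i))
        ≡⟨ ∑-comm (λ i j → seq (w i j) l * indicator (partner c j) i) ⟩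
      ℚS.sum (λ j → ℚS.sum (λ i → seq (w i j) l * indicator (partner c j) i))
        ≡⟨ sum-cong (λ j → trans (sum-indicator (λ i → seq (w i j) l) (partner c j)) (seq-maybe (λ k → w k j) (partner c j) l)) ⟩
      ℚS.sum (λ j → seq (maybe (λ k → w k j) 0ℝ (partner c j)) l)
        ≡⟨ sym (seq-sum (λ j → maybe (λ k → w k j) 0ℝ (partner c j)) l) ⟩
      seq (sum (λ j → maybe (λ k → w k j) 0ℝ (partner c j))) l ∎′

-- Counting the types that a matching uses

occurrences : ∀ {m} → Fin m → List (Fin m) → ℚ
occurrences i xs = ℚS.sum (λ v → δ (List.lookup xs v) i)

occurrences-++ : ∀ {m} (i : Fin m) xs ys → occurrences i (xs ++ ys) ≡ occurrences i xs + occurrences i ys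
occurrences-++ i []       ys = sym (+-identityˡ (occurrences i ys))
occurrences-++ i (x ∷ xs) ys = trans (cong (λ q → δ x i + q) (occurrences-++ i xs ys))
  (sym (+-assoc (δ x i) (occurrences i xs) (occurrences i ys)))

occurrences-replicate : ∀ {m} (i : Fin m) k x → occurrences i (List.replicate k x) ≡ fromℕ k * δ x i
occurrences-replicate i zero    x = sym (*-zeroˡ (δ x i))
occurrences-replicate i (suc k) x = trans (cong (λ q → δ x i + q) (occurrences-replicate i k x))
  (trans (cong (λ q → q + fromℕ k * δ x i) (sym (*-identityˡ (δ x i)))) (sym (*-distribʳ-+ (δ x i) 1ℚ (fromℕ k))))

occurrences-concat : ∀ {m n} (i : Fin m) (xs : Fin n → List (Fin m)) →
  occurrences i (List.concat (List.tabulate xs)) ≡ ℚS.sum (λ k → occurrences i (xs k))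
occurrences-concat {n = zero}  i xs = refl
occurrences-concat {n = suc n} i xs = trans (occurrences-++ i (xs zero) (List.concat (List.tabulate (xs ∘ suc))))
  (cong (λ q → occurrences i (xs zero) + q) (occurrences-concat i (xs ∘ suc)))

occurrences-arrivals : ∀ {m} (c : Vec ℕ m) i → occurrences i (arrivals c) ≡ fromℕ (Vec.lookup c i)
occurrences-arrivals c i = begin
  occurrences i (arrivals c)
    ≡⟨ occurrences-concat i (λ k → List.replicate (Vec.lookup c k) k) ⟩
  ℚS.sum (λ k → occurrences i (List.replicate (Vec.lookup c k) k))
    ≡⟨ sum-cong (λ k → trans (occurrences-replicate i (Vec.lookup c k) k)
                             (cong (λ q → fromℕ (Vec.lookup c k) * q) (δ-sym k i))) ⟩
  ℚS.sum (λ k → fromℕ (Vec.lookup c k) * δ i k)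
    ≡⟨ sum-δ (λ k → fromℕ (Vec.lookup c k)) i ⟩
  fromℕ (Vec.lookup c i) ∎
  where open ≡-Reasoning

indicator-≢ : ∀ {n} (q : Maybe (Fin n)) v → q ≢ just v → indicator q v ≡ 0ℚ
indicator-≢ nothing  v q≢ = refl
indicator-≢ (just k) v q≢ = δ-≢ k v (q≢ ∘ cong just)

-- Once some `f j` equals `just v`, uniqueness makes every later summand vanish.
at-most-once : ∀ {n N} (f : Fin n → Maybe (Fin N)) v → (∀ j k → f j ≡ just v → f k ≡ just v → j ≡ k) →
  ℚS.sum (λ j → indicator (f j) v) ≤ 1ℚ
at-most-once {zero}  f v unique = fromℕ-nonneg 1
at-most-once {suc n} f v unique with Maybe.≡-dec Fin._≟_ (f zero) (just v)
... | yes eq = ≤-reflexive (cong₂ _+_ (trans (cong (λ q → indicator q v) eq) (δ-refl v))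
        (sum-zero (λ j → indicator-≢ (f (suc j)) v (λ eq′ → contradiction (unique zero (suc j) eq eq′) λ ()))))
... | no neq = ≤-trans (≤-reflexive (trans
        (cong (λ q → q + ℚS.sum (λ j → indicator (f (suc j)) v)) (indicator-≢ (f zero) v neq)) (+-identityˡ _)))
        (at-most-once (f ∘ suc) v (λ j k eq eq′ → Fin.suc-injective (unique (suc j) (suc k) eq eq′)))

-- Double counting of the matched pairs: grouped by online vertex instead of offline vertex, each
-- online vertex of type `i` contributes at most once.
matched≤ : ∀ {N n m} (M : PartnerMap N n) → IsMatching M → ∀ (type : Fin N → Fin m) i →
  ℚS.sum (λ j → indicator (Maybe.map type (Vec.lookup M j)) i) ≤ ℚS.sum (λ v → δ (type v) i)
matched≤ M matching type i = begin
  ℚS.sum (λ j → indicator (Maybe.map type (Vec.lookup M j)) i)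
    ≡⟨ sum-cong (λ j → trans (indicator-map (Vec.lookup M j))
                             (sym (sum-indicator (λ v → δ (type v) i) (Vec.lookup M j)))) ⟩
  ℚS.sum (λ j → ℚS.sum (λ v → δ (type v) i * indicator (Vec.lookup M j) v))
    ≡⟨ ∑-comm (λ j v → δ (type v) i * indicator (Vec.lookup M j) v) ⟩
  ℚS.sum (λ v → ℚS.sum (λ j → δ (type v) i * indicator (Vec.lookup M j) v))
    ≡⟨ sum-cong (λ v → sym (*-distribˡ-sum (δ (type v) i) (λ j → indicator (Vec.lookup M j) v))) ⟩
  ℚS.sum (λ v → δ (type v) i * ℚS.sum (λ j → indicator (Vec.lookup M j) v))
    ≤⟨ sum-mono (λ v → *-monoˡ-≤-nonNeg (δ (type v) i) {{nonNegative (δ-nonneg (type v) i)}}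
         (at-most-once (Vec.lookup M) v (λ j k → matching j k v))) ⟩
  ℚS.sum (λ v → δ (type v) i * 1ℚ)
    ≡⟨ sum-cong (λ v → *-identityʳ (δ (type v) i)) ⟩
  ℚS.sum (λ v → δ (type v) i) ∎
  where
  open ≤-Reasoning
  indicator-map : ∀ q → indicator (Maybe.map type q) i ≡ maybe (λ v → δ (type v) i) 0ℚ q
  indicator-map nothing  = refl
  indicator-map (just v) = refl

-- Selecting a nearly maximum matching

⊔-lub-≼ : ∀ x y z → x ≼ z → y ≼ z → x ⊔ℝ y ≼ z
⊔-lub-≼ x y z (wrap hx) (wrap hy) = wrap λ ε 0<ε →
  eventually-map (λ _ (x≤z , y≤z) → ⊔-lub x≤z y≤z) (eventually-× (hx ε 0<ε) (hy ε 0<ε))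

x+½ε+½ε : ∀ x ε → (x +ℝ fromℚ (half ε)) +ℝ fromℚ (half ε) ≼ x +ℝ fromℚ ε
x+½ε+½ε x ε = pointwise-≡ λ l → trans (+-assoc (seq x l) (half ε) (half ε)) (cong (λ q → seq x l + q) (half+half ε))

-- At each element half of the tolerance goes to the tail and half to the approximate comparison of
-- its winner with the head. The fallback `a` answers for the base value `0ℝ` of the fold.
approximate-maximum : ∀ {A : Set} {P : A → Set} (f : A → ℝ) a → P a → 0ℝ ≼ f a → ∀ {as} → All P as →
  ∀ ε → 0ℚ < ε → ∃ λ b → P b × List.foldr _⊔ℝ_ 0ℝ (List.map f as) ≼ f b +ℝ fromℚ ε
approximate-maximum f a pa 0≼fa [] ε 0<ε = a , pa , ≼-trans 0≼fa (x≼x+ε {f a} 0<ε)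
approximate-maximum f a pa 0≼fa {x ∷ xs} (px ∷ pxs) ε 0<ε =
  let b , pb , tail = approximate-maximum f a pa 0≼fa pxs (half ε) (half-pos 0<ε) in
  Sum.[ (λ x≼b → b , pb , ⊔-lub-≼ (f x) rest (f b +ℝ fromℚ (half ε)) x≼b tail ▷ x≼x+ε {f b +ℝ fromℚ (half ε)} (half-pos 0<ε) ▷ x+½ε+½ε (f b) ε)
      , (λ b≼x → x , px , ⊔-lub-≼ (f x) rest (f x +ℝ fromℚ ε) (x≼x+ε {f x} 0<ε)
          (tail ▷ +-mono-≼ b≼x (≼-refl {fromℚ (half ε)}) ▷ x+½ε+½ε (f x) ε))
      ]′ (≼-total-approx (f x) (f b) (half-pos 0<ε))
  where
  rest = List.foldr _⊔ℝ_ 0ℝ (List.map f xs)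
  infixl 5 _▷_
  _▷_ : ∀ {x y z} → x ≼ y → y ≼ z → x ≼ z
  _▷_ = ≼-trans

maxWeight-attained : ∀ {N n} (u : Fin N → Fin n → ℝ) ε → 0ℚ < ε →
  ∃ λ M → IsMatching M × maxWeight u ≼ weight u M +ℝ fromℚ ε
maxWeight-attained {N} {n} u = approximate-maximum (weight u) empty empty-matching empty-weight
  (All.all-filter isMatching? (allVecs (nothing ∷ List.map just (List.allFin N)) n))
  where
  empty : PartnerMap N n
  -- The fallback: its weight is at least the base value of `maxWeight`.
  empty = Vec.replicate n nothing
  empty-matching : IsMatching empty
  empty-matching j k v eq _ = contradiction (trans (sym (Vec.lookup-replicate j nothing)) eq) λ ()
  empty-weight : 0ℝ ≼ weight u empty
  empty-weight = sum-nonneg-≼ λ j →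
    subst (λ q → 0ℝ ≼ maybe (λ v → u v j) 0ℝ q) (sym (Vec.lookup-replicate j nothing)) ≼-refl

theorem3 : ∀ (m n : ℕ) (w : Fin m → Fin n → ℝ) (rate : Fin m → ℝ) →
    (∀ i j → 0ℝ ≤ℝ w i j) →
    (∀ i → 0ℝ <ℝ rate i) →
    ∀ (NAT : ℝ) → IsNAT w rate NAT → OPT w rate ≤ℝ NAT
theorem3 m n w rate _ 0<rate NAT isNAT = unwrap (≼-approx {OPT w rate} {NAT} bound)
  where
  open ≼-Reasoning
  0≼rate : ∀ i → 0ℝ ≼ rate i
  0≼rate i = let ε , 0<ε , N , le = 0<rate i in wrap λ α 0<α → N , λ l N≤l →
    +-nonneg (seq (rate i) l) α (≤-trans (+-nonneg 0ℚ ε ≤-refl (<⇒≤ 0<ε)) (le l N≤l)) (<⇒≤ 0<α)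

  bound : ∀ ε → 0ℚ < ε → OPT w rate ≼ NAT +ℝ fromℚ ε
  bound ε 0<ε = begin
    OPT w rate
      -- One half of `ε` pays for the cut-off, the other for the choice of matchings. Every side
      -- from `K` on is good enough; `suc K` is the side that `Assignment` uses when given `K`.
      ∼⟨ wrap (proj₂ (converges (suc K) (ℕ.n≤1+n K))) ⟩
    partialExpectation rate (hindsightOptimum w) (suc K) +ℝ fromℚ (half ε)
      ∼⟨ +-mono-≼ (partialExpectation-mono (suc K) rate 0≼rate (λ c → proj₂ (proj₂ (best c)))) (≼-refl {fromℚ (half ε)}) ⟩
    partialExpectation rate (λ c → weight (u c) (proj₁ (best c)) +ℝ fromℚ (half ε)) (suc K) +ℝ fromℚ (half ε)
      ∼⟨ +-mono-≼ (partialExpectation-shift (suc K) rate 0≼rate (λ c → weight (u c) (proj₁ (best c))) (<⇒≤ (half-pos 0<ε)))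
                  (≼-refl {fromℚ (half ε)}) ⟩
    (partialExpectation rate (λ c → weight (u c) (proj₁ (best c))) (suc K) +ℝ fromℚ (half ε)) +ℝ fromℚ (half ε)
      ∼⟨ x+½ε+½ε (partialExpectation rate (λ c → weight (u c) (proj₁ (best c))) (suc K)) ε ⟩
    partialExpectation rate (λ c → weight (u c) (proj₁ (best c))) (suc K) +ℝ fromℚ ε
      ∼⟨ +-mono-≼ weight≼NAT (≼-refl {fromℚ ε}) ⟩
    NAT +ℝ fromℚ ε ∎
    where
    limit = lim-converges (partialExpectation rate (hindsightOptimum w))
      (partialExpectation-cauchy rate (hindsightOptimum w) (hindsightOptimum-bounded w)) (half ε) (half-pos 0<ε)
    K = proj₁ limit
    converges = proj₂ limit

    u : ∀ c → Fin (List.length (arrivals c)) → Fin n → ℝ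
    u c v = w (List.lookup (arrivals c) v)

    best : ∀ c → ∃ λ M → IsMatching M × maxWeight (u c) ≼ weight (u c) M +ℝ fromℚ (half ε)
    best c = maxWeight-attained (u c) (half ε) (half-pos 0<ε)

    -- The matching names online vertices by their position in `arrivals c`; the weights depend on
    -- the type alone, so only the type is kept.
    partner : Vec ℕ m → Fin n → Maybe (Fin m)
    partner c j = Maybe.map (List.lookup (arrivals c)) (Vec.lookup (proj₁ (best c)) j)

    open Assignment rate 0≼rate partner
      (λ c i → ≤-trans (matched≤ (proj₁ (best c)) (proj₁ (proj₂ (best c))) (List.lookup (arrivals c)) i)
                       (≤-reflexive (occurrences-arrivals c i))) K

    maybe-map : ∀ {N} (τ : Fin N → Fin m) j q l →
      seq (maybe (λ v → w (τ v) j) 0ℝ q) l ≡ seq (maybe (λ k → w k j) 0ℝ (Maybe.map τ q)) l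
    maybe-map τ j nothing  l = refl
    maybe-map τ j (just v) l = refl

    weight≼NAT : partialExpectation rate (λ c → weight (u c) (proj₁ (best c))) (suc K) ≼ NAT
    weight≼NAT = begin
      partialExpectation rate (λ c → weight (u c) (proj₁ (best c))) (suc K)
        ∼⟨ pointwise-≡ (λ l → partialExpectation-cong (suc K) rate (λ c → weight (u c) (proj₁ (best c)))
             (λ c → sum (λ j → maybe (λ k → w k j) 0ℝ (partner c j))) l (λ c → seq-sum-cong
             (λ j → maybe (λ v → u c v j) 0ℝ (Vec.lookup (proj₁ (best c)) j))
             (λ j → maybe (λ k → w k j) 0ℝ (partner c j)) l (λ j → maybe-map (List.lookup (arrivals c)) j (Vec.lookup (proj₁ (best c)) j) l))) ⟩
      partialExpectation rate (λ c → sum (λ j → maybe (λ k → w k j) 0ℝ (partner c j))) (suc K)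
        ∼⟨ objective-flow w ⟩
      objective w flow
        ∼⟨ wrap (IsNAT.upperBound isNAT flow feasible) ⟩
      NAT ∎
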